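{- Let $q=2^m$ for some integer $m\ge2$. Then there exists a distance-biregular graph with intersection array \[ \begin{vmatrix} q+2; & 1, & 2, & \frac{(q+1)q}{4}, & q+2 \\ \frac{q(q-1)}{2}; & 1, & \frac q2, & q+1, & \frac{q(q-1)}{2}\end{vmatrix}. \]
   Context: A bipartite graph with bipartition $Y\cup Z$ is distance-biregular if for every vertex $a$, every $i$, and every vertex $w$ at distance $i$ from $a$, the numbers $c_i(a)=|\{u\sim w: d(a,u)=i-1\}|$ and $b_i(a)=|\{u\sim w: d(a,u)=i+1\}|$ depend only on $i$ and on which part contains $a$. The intersection array $\begin{vmatrix} k; & c_1^{Y}, & \dots, & c_{d_Y}^{Y} \\ \ell; & c_1^{Z}, & \dots, & c_{d_Z}^{Z}\end{vmatrix}$ records the valency $k$ of vertices in $Y$, the valency $\ell$ of vertices in $Z$, and the numbers $c_i$ (for vertices in $Y$, resp. $Z$) for $1\le i\le d_Y$ (resp. $d_Z$), the eccentricities of vertices in $Y$ (resp. $Z$). -}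

module Defs where

open import Data.Nat using (ℕ; zero; suc; _+_; _*_; _∸_; _^_; _/_; _≤_)
open import Data.Bool using (Bool; true; false; _∧_; _∨_; not; if_then_else_)
open import Data.Fin using (Fin; toℕ) renaming (zero to fz; suc to fs)
open import Data.Fin.Properties using (_≟_)
open import Data.Vec using (Vec; lookup; []; _∷_)
open import Data.Product using (Σ; ∃; _×_)
open import Relation.Nullary.Decidable using (⌊_⌋)
open import Relation.Binary.PropositionalEquality using (_≡_; _≢_)
open import Function using (_∘_)

count : ∀ {n} → (Fin n → Bool) → ℕ
count {zero}  p = 0
count {suc n} p = (if p fz then 1 else 0) + count (p ∘ fs)

anyV : ∀ {n} → (Fin n → Bool) → Bool
anyV {zero}  p = false
anyV {suc n} p = p fz ∨ anyV (p ∘ fs)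

-- A finite simple bipartite graph on vertex set Fin n with a fixed
-- bipartition Y ∪ Z (inY v ≡ true means v ∈ Y, otherwise v ∈ Z).
-- Every edge joins Y to Z (in particular there are no loops).
record BipGraph : Set where
  field
    n         : ℕ
    adj       : Fin n → Fin n → Bool
    inY       : Fin n → Bool
    adj-sym   : ∀ u v → adj u v ≡ adj v u
    bipartite : ∀ u v → adj u v ≡ true → inY u ≢ inY v

  walkWithin : ℕ → Fin n → Fin n → Bool
  walkWithin zero    a b = ⌊ a ≟ b ⌋
  walkWithin (suc j) a b = walkWithin j a b ∨ anyV (λ u → walkWithin j a u ∧ adj u b)

  isDist : Fin n → Fin n → ℕ → Bool
  isDist a b zero    = walkWithin zero a b
  isDist a b (suc i) = walkWithin (suc i) a b ∧ not (walkWithin i a b)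

  Dist : Fin n → Fin n → ℕ → Set
  Dist a b i = isDist a b i ≡ true

  degree : Fin n → ℕ
  degree w = count (adj w)

  -- c_i(a) at w : neighbours u of w with d(a,u) = i - 1   (used for i ≥ 1)
  cnum : Fin n → Fin n → ℕ → ℕ
  cnum a w i = count (λ u → adj w u ∧ isDist a u (i ∸ 1))

  bnum : Fin n → Fin n → ℕ → ℕ
  bnum a w i = count (λ u → adj w u ∧ isDist a u (suc i))

-- Distance-biregular with intersection array
--   | k ; c^Y_1 ... c^Y_{dY} |
--   | l ; c^Z_1 ... c^Z_{dZ} |
-- The vector entry at index i (0-based) is c_{i+1}.
-- dY, dZ are the eccentricities of the vertices of Y, resp. Z.
record DistanceBiregular (G : BipGraph) (k l dY dZ : ℕ)
                         (cY : Vec ℕ dY) (cZ : Vec ℕ dZ) : Set where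
  open BipGraph G
  field
    Y-nonempty : ∃ λ a → inY a ≡ true
    Z-nonempty : ∃ λ a → inY a ≡ false
    valY : ∀ a → inY a ≡ true  → degree a ≡ k
    valZ : ∀ a → inY a ≡ false → degree a ≡ l
    eccY-bound : ∀ a → inY a ≡ true  → ∀ w → walkWithin dY a w ≡ true
    eccY-attained : ∀ a → inY a ≡ true  → ∃ λ w → Dist a w dY
    eccZ-bound : ∀ a → inY a ≡ false → ∀ w → walkWithin dZ a w ≡ true
    eccZ-attained : ∀ a → inY a ≡ false → ∃ λ w → Dist a w dZ
    cY-val : ∀ a → inY a ≡ true  → ∀ (i : Fin dY) w →
             Dist a w (suc (toℕ i)) → cnum a w (suc (toℕ i)) ≡ lookup cY i
    cZ-val : ∀ a → inY a ≡ false → ∀ (i : Fin dZ) w →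
             Dist a w (suc (toℕ i)) → cnum a w (suc (toℕ i)) ≡ lookup cZ i
    bY-reg : Σ (ℕ → ℕ) λ β → ∀ a → inY a ≡ true  → ∀ i w → Dist a w i → bnum a w i ≡ β i
    bZ-reg : Σ (ℕ → ℕ) λ β → ∀ a → inY a ≡ false → ∀ i w → Dist a w i → bnum a w i ≡ β i

{-# OPTIONS --safe #-}
module Submission where

-- Let f_i be the q + 2 linear forms on F_q³ given by the points i of a hyperoval (a conic with
-- its nucleus). A nonzero vector is killed by exactly 0 or 2 of them. The graph joins the vectors
-- v on which no form vanishes to the pairs (i, s), s ≠ 0, with f_i(v) = s: distinct v, w have
-- as many common neighbours as v − w has zeros, that is 0 or 2, and counting zeros along the line
-- f_i = s, f_j = t shows that q / 2 of its points v have no zero.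
--
-- For F_q, q = 2^m, take R = F₂[X]/(Xⁿ − 1) with n = q − 1. Frobenius gives a^q = a for all a in R,
-- so every a has the idempotent support aⁿ. The product of the X^(2^d) + X over 1 ≤ d < m is nonzero,
-- being monic of degree n − 1. Below its support choose an idempotent e such that each e aⁿ is 0 or e.
-- Then eR is a field in which ξ = eX has m distinct conjugates, hence no relation of degree < m,
-- so eR has at least 2^m elements; it has at most that many since all are roots of x^q + x.

open import Defs
open import Algebra using (CommutativeRing; CommutativeSemigroup; Op₂)
open import Algebra.Structures using (IsCommutativeRing; IsSemigroup)
open import Axiom.UniquenessOfIdentityProofs.WithK using (uip)
open import Data.Bool using (Bool; true; false; _∧_; _∨_; _xor_; not; if_then_else_; T)
import Data.Bool.Properties as Bool
open import Data.Empty using (⊥; ⊥-elim)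
open import Data.Fin using (Fin; toℕ; fromℕ; fromℕ<; inject₁) renaming (zero to fz; suc to fs)
import Data.Fin.Properties as Fin
open import Data.Fin.Properties using (toℕ-fromℕ; toℕ-inject₁; toℕ-fromℕ<; toℕ<n)
open import Data.List as List using (List; []; _∷_; map; _++_; length; cartesianProduct; replicate; applyUpTo)
open import Data.List.Membership.Propositional using (_∈_)
open import Data.List.Membership.Propositional.Properties using (∈-map⁺; ∈-map⁻; ∈-++⁺ˡ; ∈-++⁺ʳ; ∈-cartesianProduct⁺)
open import Data.List.Properties using (length-map; length-++; length-replicate; length-applyUpTo)
open import Data.List.Relation.Unary.All as All using (All; []; _∷_)
import Data.List.Relation.Unary.All.Properties as All
open import Data.List.Relation.Unary.AllPairs using ([]; _∷_)
open import Data.List.Relation.Unary.Any using (here; there; index)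
open import Data.List.Relation.Unary.Any.Properties using (lookup-index)
open import Data.List.Relation.Unary.Unique.Propositional using (Unique)
import Data.List.Relation.Unary.Unique.Propositional.Properties as Unique
open import Data.Nat using (ℕ; zero; suc; _+_; _*_; _∸_; _^_; _/_; _≤_; _<_; z≤n; s≤s; _≡ᵇ_)
import Data.Nat as ℕ
open import Data.Nat.DivMod using (m*n/n≡m)
open import Data.Nat.Properties hiding (_≟_)
open import Data.Product using (Σ; ∃; _×_; _,_; proj₁; proj₂)
import Data.Product.Properties as Product
open import Data.Sum using (_⊎_; inj₁; inj₂)
import Data.Sum.Properties as Sum
open import Data.Vec as Vec using (Vec; []; _∷_; lookup; tabulate; zipWith; toList)
import Data.Vec.Properties as Vec
open import Function using (_∘_; id)
open import Level using (0ℓ)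
open import Relation.Binary using (DecidableEquality)
open import Relation.Binary.PropositionalEquality
open import Relation.Nullary using (Dec; yes; no; does; ¬_; contradiction)
open import Relation.Nullary.Decidable using (dec-true; dec-false; map′)

-- The obstacle on the field side is an irreducible polynomial of degree m over F₂ for every m. The
-- ring R avoids it: R is a product of fields of order 2^d with d dividing m, and X^(2^d) + X
-- vanishes on each component of order 2^d. Hence the product over d < m survives exactly on the
-- components of order q, and an idempotent below its support that no other support can cut selects
-- one of them. On the graph side only the counts collected in `Code`, with h = q / 2, are used, and
-- they yield the whole array. Two words share 0 or 2 places, two places at different indices share
-- h words, and c₃ = (q + 1) q / 4 arises because each of the q + 1 remaining indices offers h words
-- while every suitable word is found twice. Eccentricity 4 needs pairs of words, and pairs of
-- symbols, that differ throughout; they come from a scalar other than 0 and 1, available because q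
-- > 2.

private variable
  A B : Set

-- Finite sums of natural numbers.

ι : Bool → ℕ
ι b = if b then 1 else 0

ι-yes : {P : Set} (d : Dec P) → P → ι (does d) ≡ 1
ι-yes d p = cong ι (dec-true d p)

ι-no : {P : Set} (d : Dec P) → ¬ P → ι (does d) ≡ 0
ι-no d ¬p = cong ι (dec-false d ¬p)

ι-cong : {P Q : Set} (d : Dec P) (d′ : Dec Q) → (P → Q) → (Q → P) → ι (does d) ≡ ι (does d′)
ι-cong d (yes q) _ g = ι-yes d (g q)
ι-cong d (no ¬q) f _ = ι-no d (¬q ∘ f)

ι-∧ : ∀ b c → ι (b ∧ c) ≡ ι b * ι c
ι-∧ false c = refl
ι-∧ true  c = sym (+-identityʳ _)

∑ : List A → (A → ℕ) → ℕ
∑ []       f = 0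
∑ (x ∷ xs) f = f x + ∑ xs f

∑-cong : (xs : List A) {f g : A → ℕ} → (∀ x → f x ≡ g x) → ∑ xs f ≡ ∑ xs g
∑-cong []       e = refl
∑-cong (x ∷ xs) e = cong₂ _+_ (e x) (∑-cong xs e)

∑-const : (xs : List A) (k : ℕ) → ∑ xs (λ _ → k) ≡ length xs * k
∑-const []       k = refl
∑-const (x ∷ xs) k = cong (k +_) (∑-const xs k)

∑-one : (xs : List A) → ∑ xs (λ _ → 1) ≡ length xs
∑-one xs = trans (∑-const xs 1) (*-identityʳ _)

∑-zero : (xs : List A) {f : A → ℕ} → (∀ x → f x ≡ 0) → ∑ xs f ≡ 0
∑-zero xs e = trans (∑-cong xs e) (trans (∑-const xs 0) (*-zeroʳ (length xs)))

∑-+ : (xs : List A) (f g : A → ℕ) → ∑ xs (λ x → f x + g x) ≡ ∑ xs f + ∑ xs g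
∑-+ []       f g = refl
∑-+ (x ∷ xs) f g = begin
  f x + g x + ∑ xs (λ x → f x + g x) ≡⟨ cong (f x + g x +_) (∑-+ xs f g) ⟩
  f x + g x + (∑ xs f + ∑ xs g)      ≡⟨ interchange (f x) (g x) (∑ xs f) (∑ xs g) ⟩
  f x + ∑ xs f + (g x + ∑ xs g)      ∎
  where
  open ≡-Reasoning
  open import Algebra.Properties.CommutativeSemigroup +-commutativeSemigroup using (interchange)

∑-*ˡ : (xs : List A) (k : ℕ) (f : A → ℕ) → ∑ xs (λ x → k * f x) ≡ k * ∑ xs f
∑-*ˡ []       k f = sym (*-zeroʳ k)
∑-*ˡ (x ∷ xs) k f = trans (cong (k * f x +_) (∑-*ˡ xs k f)) (sym (*-distribˡ-+ k (f x) (∑ xs f)))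

∑-swap : (xs : List A) (ys : List B) (f : A → B → ℕ) →
         ∑ xs (λ x → ∑ ys (f x)) ≡ ∑ ys (λ y → ∑ xs (λ x → f x y))
∑-swap []       ys f = sym (∑-zero ys (λ _ → refl))
∑-swap (x ∷ xs) ys f = trans (cong (∑ ys (f x) +_) (∑-swap xs ys f)) (sym (∑-+ ys (f x) _))

∑-++ : (xs ys : List A) (f : A → ℕ) → ∑ (xs ++ ys) f ≡ ∑ xs f + ∑ ys f
∑-++ []       ys f = refl
∑-++ (x ∷ xs) ys f = trans (cong (f x +_) (∑-++ xs ys f)) (sym (+-assoc (f x) _ _))

∑-map : (g : A → B) (xs : List A) (f : B → ℕ) → ∑ (map g xs) f ≡ ∑ xs (f ∘ g)
∑-map g []       f = refl
∑-map g (x ∷ xs) f = cong (f (g x) +_) (∑-map g xs f)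

∑-× : (xs : List A) (ys : List B) (f : A × B → ℕ) →
      ∑ (cartesianProduct xs ys) f ≡ ∑ xs (λ x → ∑ ys (λ y → f (x , y)))
∑-× []       ys f = refl
∑-× (x ∷ xs) ys f = trans (∑-++ (map (x ,_) ys) _ f) (cong₂ _+_ (∑-map (x ,_) ys f) (∑-× xs ys f))

∑-mono : (xs : List A) {f g : A → ℕ} → (∀ x → f x ≤ g x) → ∑ xs f ≤ ∑ xs g
∑-mono []       e = z≤n
∑-mono (x ∷ xs) e = +-mono-≤ (e x) (∑-mono xs e)

∑-positive : (xs : List A) (f : A → ℕ) → 0 < ∑ xs f → ∃ λ x → 0 < f x
∑-positive (x ∷ xs) f p with f x in eq
... | suc _ = x , subst (0 <_) (sym eq) (s≤s z≤n)
... | zero  = ∑-positive xs f p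

-- The other terms sum to at most their number, so they cannot make up for a single term below 1.
∑-saturated : (xs : List A) {f : A → ℕ} → (∀ x → f x ≤ 1) → length xs ≤ ∑ xs f →
              ∀ {a} → a ∈ xs → f a ≡ 1
∑-saturated (x ∷ xs) {f} le big {a} (here refl) =
  ≤-antisym (le a) (+-cancelʳ-≤ _ 1 (f a) (≤-trans (s≤s bound) big))
  where
  bound : ∑ xs f ≤ length xs
  bound = subst (∑ xs f ≤_) (∑-one xs) (∑-mono xs le)
∑-saturated (x ∷ xs) {f} le big (there a∈xs) =
  ∑-saturated xs le (+-cancelˡ-≤ 1 _ _ (≤-trans big (+-monoˡ-≤ _ (le x)))) a∈xs

-- Finite types and counting by sums over their elements.

record Finite (A : Set) : Set where
  infix 4 _≟_
  field
    _≟_      : DecidableEquality A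
    elems    : List A
    unique   : Unique elems
    complete : ∀ a → a ∈ elems

  size : ℕ
  size = length elems

  δ : A → A → ℕ
  δ x y = ι (does (x ≟ y))

  private
    absent : ∀ a {xs} → All (a ≢_) xs → ∑ xs (λ x → δ x a) ≡ 0
    absent a []           = refl
    absent a (a≢x ∷ a∉xs) = cong₂ _+_ (ι-no (_ ≟ a) (a≢x ∘ sym)) (absent a a∉xs)

    present : ∀ a {xs} → Unique xs → a ∈ xs → ∑ xs (λ x → δ x a) ≡ 1
    present a (x∉xs ∷ _) (here refl) = cong₂ _+_ (ι-yes (a ≟ a) refl) (absent a x∉xs)
    present a (x∉xs ∷ u) (there a∈xs) =
      cong₂ _+_ (ι-no (_ ≟ a) λ { refl → All.lookup x∉xs a∈xs refl }) (present a u a∈xs)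

  -- Completeness gives one hit and uniqueness excludes a second. All later cardinalities and counts
  -- go through this identity.
  ∑-δ : ∀ a → ∑ elems (λ x → δ x a) ≡ 1
  ∑-δ a = present a unique (complete a)

  ∑-δ* : ∀ a (f : A → ℕ) → ∑ elems (λ x → δ x a * f x) ≡ f a
  ∑-δ* a f = begin
    ∑ elems (λ x → δ x a * f x) ≡⟨ ∑-cong elems pointwise ⟩
    ∑ elems (λ x → f a * δ x a) ≡⟨ ∑-*ˡ elems (f a) _ ⟩
    f a * ∑ elems (λ x → δ x a) ≡⟨ cong (f a *_) (∑-δ a) ⟩
    f a * 1                     ≡⟨ *-identityʳ (f a) ⟩
    f a                         ∎
    where
    open ≡-Reasoning
    pointwise : ∀ x → δ x a * f x ≡ f a * δ x a
    pointwise x with x ≟ a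
    ... | yes refl = trans (+-identityʳ _) (sym (*-identityʳ _))
    ... | no _     = sym (*-zeroʳ (f a))

  ∑-unique : {P : A → Set} (P? : ∀ x → Dec (P x)) → ∀ a → P a → (∀ x → P x → x ≡ a) →
             ∑ elems (λ x → ι (does (P? x))) ≡ 1
  ∑-unique {P} P? a pa only =
    trans (∑-cong elems λ x → ι-cong (P? x) (x ≟ a) (only x) (λ x≡a → subst P (sym x≡a) pa)) (∑-δ a)

  ≤∑ : ∀ a (f : A → ℕ) → f a ≤ ∑ elems f
  ≤∑ a f = subst (_≤ ∑ elems f) (∑-δ* a f) (∑-mono elems pointwise)
    where
    pointwise : ∀ x → δ x a * f x ≤ f x
    pointwise x with does (x ≟ a)
    ... | true  = ≤-reflexive (+-identityʳ _)
    ... | false = z≤n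

open Finite

finite-Bool : Finite Bool
finite-Bool = record
  { _≟_ = Bool._≟_ ; elems = true ∷ false ∷ [] ; unique = ((λ ()) ∷ []) ∷ [] ∷ []
  ; complete = λ { true → here refl ; false → there (here refl) } }

infixr 2 _⊗_
infixr 1 _⊕_

_⊗_ : Finite A → Finite B → Finite (A × B)
FA ⊗ FB = record
  { _≟_ = Product.≡-dec (_≟_ FA) (_≟_ FB)
  ; elems = cartesianProduct (elems FA) (elems FB)
  ; unique = Unique.cartesianProduct⁺ (unique FA) (unique FB)
  ; complete = λ (a , b) → ∈-cartesianProduct⁺ (complete FA a) (complete FB b) }

_⊕_ : Finite A → Finite B → Finite (A ⊎ B)
FA ⊕ FB = record
  { _≟_ = Sum.≡-dec (_≟_ FA) (_≟_ FB)
  ; elems = map inj₁ (elems FA) ++ map inj₂ (elems FB)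
  ; unique = Unique.++⁺ (Unique.map⁺ Sum.inj₁-injective (unique FA)) (Unique.map⁺ Sum.inj₂-injective (unique FB))
      (λ (p , q) → disjoint p q)
  ; complete = λ { (inj₁ a) → ∈-++⁺ˡ (∈-map⁺ inj₁ (complete FA a))
                 ; (inj₂ b) → ∈-++⁺ʳ _ (∈-map⁺ inj₂ (complete FB b)) } }
  where
  disjoint : ∀ {x} → x ∈ map inj₁ (elems FA) → ¬ (x ∈ map inj₂ (elems FB))
  disjoint p q with ∈-map⁻ inj₁ p | ∈-map⁻ inj₂ q
  ... | _ , _ , refl | _ , _ , ()

∑-⊕ : (FA : Finite A) (FB : Finite B) (f : A ⊎ B → ℕ) →
      ∑ (elems (FA ⊕ FB)) f ≡ ∑ (elems FA) (f ∘ inj₁) + ∑ (elems FB) (f ∘ inj₂)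
∑-⊕ FA FB f = trans (∑-++ (map inj₁ (elems FA)) _ f)
  (cong₂ _+_ (∑-map inj₁ (elems FA) f) (∑-map inj₂ (elems FB) f))

image : (FA : Finite A) → DecidableEquality B → (f : A → B) →
        (∀ {x y} → f x ≡ f y → x ≡ y) → (∀ b → b ∈ map f (elems FA)) → Finite B
image FA _≟B_ f inj surj = record
  { _≟_ = _≟B_ ; elems = map f (elems FA) ; unique = Unique.map⁺ inj (unique FA) ; complete = surj }

finite-Vec : ∀ n → Finite (Vec Bool n)
finite-Vec zero = record
  { _≟_ = Vec.≡-dec Bool._≟_ ; elems = [] ∷ [] ; unique = [] ∷ [] ; complete = λ { [] → here refl } }
finite-Vec (suc n) = image (finite-Bool ⊗ finite-Vec n) (Vec.≡-dec Bool._≟_) (λ (b , v) → b ∷ v)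
  (λ { refl → refl }) (λ { (b ∷ v) → ∈-map⁺ _ (complete (finite-Bool ⊗ finite-Vec n) (b , v)) })

length-cartesianProduct : (xs : List A) (ys : List B) → length (cartesianProduct xs ys) ≡ length xs * length ys
length-cartesianProduct xs ys = begin
  length (cartesianProduct xs ys)     ≡⟨ ∑-one (cartesianProduct xs ys) ⟨
  ∑ (cartesianProduct xs ys) (λ _ → 1) ≡⟨ ∑-× xs ys _ ⟩
  ∑ xs (λ _ → ∑ ys (λ _ → 1))          ≡⟨ ∑-const xs _ ⟩
  length xs * ∑ ys (λ _ → 1)           ≡⟨ cong (length xs *_) (∑-one ys) ⟩
  length xs * length ys                ∎
  where open ≡-Reasoning

size-Vec : ∀ n → size (finite-Vec n) ≡ 2 ^ n
size-Vec zero    = refl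
size-Vec (suc n) = begin
  length (map _ (cartesianProduct (true ∷ false ∷ []) vs)) ≡⟨ length-map _ (cartesianProduct (true ∷ false ∷ []) vs) ⟩
  length (cartesianProduct (true ∷ false ∷ []) vs)         ≡⟨ length-cartesianProduct (true ∷ false ∷ []) vs ⟩
  2 * length vs                                            ≡⟨ cong (2 *_) (size-Vec n) ⟩
  2 * 2 ^ n                                                ∎
  where
  open ≡-Reasoning
  vs = elems (finite-Vec n)

-- Decidable subsets and injections between finite types.

Subset : (A → Bool) → Set
Subset {A} p = Σ A λ a → p a ≡ true

Subset-≡ : {p : A → Bool} {x y : Subset p} → proj₁ x ≡ proj₁ y → x ≡ y
Subset-≡ {x = a , pa} {y = .a , pa′} refl = cong (a ,_) (uip pa pa′)

module _ {A : Set} (p : A → Bool) where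

  -- The outcome of the test is a separate argument `b` with its equation, so that the lemmas below
  -- can match on `b` while `select` passes `refl`.
  consider : ∀ x {b} → p x ≡ b → List (Subset p) → List (Subset p)
  consider x {true}  px rest = (x , px) ∷ rest
  consider x {false} _  rest = rest

  select : List A → List (Subset p)
  select []       = []
  select (x ∷ xs) = consider x refl (select xs)

  ∈-consider : ∀ {s x b} (e : p x ≡ b) {rest} → proj₁ s ≡ x ⊎ s ∈ rest → s ∈ consider x e rest
  ∈-consider         {b = true}  e (inj₁ refl) = here (Subset-≡ refl)
  ∈-consider         {b = true}  e (inj₂ s∈)   = there s∈
  ∈-consider {a , q} {b = false} e (inj₁ refl) = contradiction (trans (sym q) e) λ ()
  ∈-consider         {b = false} e (inj₂ s∈)   = s∈

  ∈-select : ∀ {xs} (s : Subset p) → proj₁ s ∈ xs → s ∈ select xs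
  ∈-select {x ∷ xs} s (here s≡x) = ∈-consider refl (inj₁ s≡x)
  ∈-select {x ∷ xs} s (there s∈) = ∈-consider refl (inj₂ (∈-select s s∈))

  All-consider : {Q : Subset p → Set} → ∀ {x b} (e : p x ≡ b) {rest} →
                 (∀ px → Q (x , px)) → All Q rest → All Q (consider x e rest)
  All-consider {b = true}  e qx qs = qx e ∷ qs
  All-consider {b = false} e qx qs = qs

  ∉-select : ∀ {a xs} → All (a ≢_) xs → All (λ s → a ≢ proj₁ s) (select xs)
  ∉-select []           = []
  ∉-select (a≢x ∷ a∉xs) = All-consider refl (λ _ → a≢x) (∉-select a∉xs)

  unique-consider : ∀ {x b} (e : p x ≡ b) {rest} →
                    All (λ s → x ≢ proj₁ s) rest → Unique rest → Unique (consider x e rest)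
  unique-consider {b = true}  e x∉ u = All.map (λ x≢s x≡s → x≢s (cong proj₁ x≡s)) x∉ ∷ u
  unique-consider {b = false} e x∉ u = u

  unique-select : ∀ {xs} → Unique xs → Unique (select xs)
  unique-select []         = []
  unique-select (x∉xs ∷ u) = unique-consider refl (∉-select x∉xs) (unique-select u)

  ∑-consider : ∀ x {b} (e : p x ≡ b) rest (f : A → ℕ) →
               ∑ (consider x e rest) (f ∘ proj₁) ≡ ι b * f x + ∑ rest (f ∘ proj₁)
  ∑-consider x {true}  e rest f = cong (_+ ∑ rest (f ∘ proj₁)) (sym (+-identityʳ (f x)))
  ∑-consider x {false} e rest f = refl

  ∑-select : ∀ xs (f : A → ℕ) → ∑ (select xs) (f ∘ proj₁) ≡ ∑ xs (λ x → ι (p x) * f x)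
  ∑-select []       f = refl
  ∑-select (x ∷ xs) f = trans (∑-consider x refl (select xs) f) (cong (ι (p x) * f x +_) (∑-select xs f))

  finite-Subset : Finite A → Finite (Subset p)
  finite-Subset FA = record
    { _≟_ = λ x y → map′ Subset-≡ (cong proj₁) (_≟_ FA (proj₁ x) (proj₁ y))
    ; elems = select (elems FA) ; unique = unique-select (unique FA)
    ; complete = λ s → ∈-select s (complete FA (proj₁ s)) }

∑-δ-sym : (FA : Finite A) → ∀ a → ∑ (elems FA) (λ x → δ FA a x) ≡ 1
∑-δ-sym FA a = trans (∑-cong (elems FA) λ x → ι-cong (_≟_ FA a x) (_≟_ FA x a) sym sym) (∑-δ FA a)

module _ (FA : Finite A) (FB : Finite B) (f : A → B) (inj : ∀ {x y} → f x ≡ f y → x ≡ y) where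

  private
    fibre-≤1 : ∀ b → ∑ (elems FA) (λ x → δ FB (f x) b) ≤ 1
    fibre-≤1 b with ∑ (elems FA) (λ x → δ FB (f x) b) in eq
    ... | zero  = z≤n
    ... | suc k with ∑-positive (elems FA) (λ x → δ FB (f x) b) (subst (0 <_) (sym eq) (s≤s z≤n))
    ...   | a , pos with _≟_ FB (f a) b
    ...     | yes refl = ≤-reflexive (trans (sym eq)
      (∑-unique FA (λ x → _≟_ FB (f x) (f a)) a refl (λ x → inj)))

  -- The pigeonhole principle in counting form: by injectivity each fibre has at most one element,
  -- and the fibre sizes add up to `size FA`, so none can be empty.
  fibre-singleton : size FB ≤ size FA → ∀ b → ∑ (elems FA) (λ x → δ FB (f x) b) ≡ 1
  fibre-singleton le b = ∑-saturated (elems FB) fibre-≤1 total (complete FB b)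
    where
    total : size FB ≤ ∑ (elems FB) (λ b → ∑ (elems FA) (λ x → δ FB (f x) b))
    total = begin
      size FB ≤⟨ le ⟩
      size FA ≡⟨ ∑-one (elems FA) ⟨
      ∑ (elems FA) (λ _ → 1) ≡⟨ ∑-cong (elems FA) (λ x → ∑-δ-sym FB (f x)) ⟨
      ∑ (elems FA) (λ x → ∑ (elems FB) (λ b → δ FB (f x) b)) ≡⟨ ∑-swap (elems FA) (elems FB) _ ⟩
      ∑ (elems FB) (λ b → ∑ (elems FA) (λ x → δ FB (f x) b)) ∎
      where open ≤-Reasoning

-- Rings of characteristic 2

-- Negation is the identity, which is how characteristic 2 is expressed.
record Char2Ring : Set₁ where
  infixl 6 _∔_
  infixl 7 _·_
  field
    Carrier           : Set
    _∔_ _·_           : Op₂ Carrier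
    𝟘 𝟙               : Carrier
    isCommutativeRing : IsCommutativeRing _≡_ _∔_ _·_ id 𝟘 𝟙

  commutativeRing : CommutativeRing 0ℓ 0ℓ
  commutativeRing = record { isCommutativeRing = isCommutativeRing }

  open CommutativeRing commutativeRing public using (commutativeSemiring)
  open IsCommutativeRing isCommutativeRing public
    using (zeroˡ; zeroʳ; distribˡ; distribʳ)
    renaming (*-assoc to ·-assoc; *-comm to ·-comm;
      *-identityˡ to ·-identityˡ; *-identityʳ to ·-identityʳ;
      +-identityˡ to ∔-identityˡ; +-identityʳ to ∔-identityʳ;
      +-assoc to ∔-assoc; +-comm to ∔-comm; -‿inverseʳ to ∔-self)

module Char2 (R : Char2Ring) where
  open Char2Ring R public
  open import Algebra.Properties.CommutativeSemiring.Exp commutativeSemiring public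
    using () renaming (_^_ to _↑_; ^-homo-* to ↑-+; ^-assocʳ to ↑-*; ^-distrib-* to ↑-distrib-·)

  bit : Bool → Carrier
  bit b = if b then 𝟙 else 𝟘

  module Solver where
    open import Algebra.Solver.Ring.AlmostCommutativeRing using (_-Raw-AlmostCommutative⟶_; fromCommutativeRing)
    open import Data.Maybe using (Maybe; just; nothing)

    -- The Booleans under `xor` and `∧` are F₂. With these coefficients the solver normalises a + a
    -- to zero, so characteristic 2 is built into each of its identities.
    homo : CommutativeRing.rawRing Bool.xor-∧-commutativeRing
           -Raw-AlmostCommutative⟶ fromCommutativeRing commutativeRing
    homo = record
      { ⟦_⟧ = bit
      ; +-homo = λ { false b → sym (∔-identityˡ (bit b)) ; true false → sym (∔-identityʳ 𝟙)
                   ; true true → sym (∔-self 𝟙) }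
      ; *-homo = λ { false b → sym (zeroˡ (bit b)) ; true b → sym (·-identityˡ (bit b)) }
      ; -‿homo = λ _ → refl ; 0-homo = refl ; 1-homo = refl }

    bit≟ : ∀ b c → Maybe (bit b ≡ bit c)
    bit≟ false false = just refl
    bit≟ true  true  = just refl
    bit≟ _     _     = nothing

    open import Algebra.Solver.Ring (CommutativeRing.rawRing Bool.xor-∧-commutativeRing)
      (fromCommutativeRing commutativeRing) homo bit≟ public
      using (solve; _:+_; _:*_; _:=_; con)

  open Solver public

  ∔-cancel : ∀ {a b} → a ∔ b ≡ 𝟘 → a ≡ b
  ∔-cancel {a} {b} e = begin
    a           ≡⟨ solve 2 (λ a b → a := (a :+ b) :+ b) refl a b ⟩
    (a ∔ b) ∔ b ≡⟨ cong (_∔ b) e ⟩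
    𝟘 ∔ b       ≡⟨ ∔-identityˡ b ⟩
    b           ∎
    where open ≡-Reasoning

  ≡⇒∔ : ∀ {a b} → a ≡ b → a ∔ b ≡ 𝟘
  ≡⇒∔ {a} refl = ∔-self a

  -- The d-fold iterate of squaring, which is additive because the two cross terms cancel.
  frobenius : ∀ d a b → (a ∔ b) ↑ (2 ^ d) ≡ a ↑ (2 ^ d) ∔ b ↑ (2 ^ d)
  frobenius zero    a b =
    solve 2 (λ a b → (a :+ b) :* con true := a :* con true :+ b :* con true) refl a b
  frobenius (suc d) a b = begin
    (a ∔ b) ↑ (2 * 2 ^ d)                   ≡⟨ ↑-* (a ∔ b) 2 (2 ^ d) ⟨
    ((a ∔ b) ↑ 2) ↑ (2 ^ d)                 ≡⟨ cong (_↑ (2 ^ d)) square-∔ ⟩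
    (a ↑ 2 ∔ b ↑ 2) ↑ (2 ^ d)               ≡⟨ frobenius d (a ↑ 2) (b ↑ 2) ⟩
    (a ↑ 2) ↑ (2 ^ d) ∔ (b ↑ 2) ↑ (2 ^ d)   ≡⟨ cong₂ _∔_ (↑-* a 2 (2 ^ d)) (↑-* b 2 (2 ^ d)) ⟩
    a ↑ (2 * 2 ^ d) ∔ b ↑ (2 * 2 ^ d)       ∎
    where
    open ≡-Reasoning
    square-∔ : (a ∔ b) ↑ 2 ≡ a ↑ 2 ∔ b ↑ 2
    square-∔ = solve 2 (λ a b → (a :+ b) :* ((a :+ b) :* con true) :=
      a :* (a :* con true) :+ b :* (b :* con true)) refl a b

  𝟙-↑ : ∀ k → 𝟙 ↑ k ≡ 𝟙
  𝟙-↑ zero    = refl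
  𝟙-↑ (suc k) = trans (·-identityˡ _) (𝟙-↑ k)

  bit-frobenius : ∀ d b → bit b ↑ (2 ^ d) ≡ bit b
  bit-frobenius d true  = 𝟙-↑ (2 ^ d)
  -- The exponent has to be exposed as a successor, since `𝟘 ↑ 0` is `𝟙`.
  bit-frobenius d false with 2 ^ d | m^n>0 2 d
  ... | suc k | _ = zeroˡ _

  -- Polynomials, the Frobenius map and roots.

  eval : List Carrier → Carrier → Carrier
  eval []       x = 𝟘
  eval (c ∷ cs) x = c ∔ x · eval cs x

  -- Frobenius is a ring homomorphism that fixes coefficients from F₂; hence it carries roots of
  -- such a polynomial to roots.
  eval-frobenius : ∀ d bs x → eval (map bit bs) x ↑ (2 ^ d) ≡ eval (map bit bs) (x ↑ (2 ^ d))
  eval-frobenius d []       x = bit-frobenius d false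
  eval-frobenius d (b ∷ bs) x = begin
    (bit b ∔ x · r) ↑ (2 ^ d)                 ≡⟨ frobenius d (bit b) (x · r) ⟩
    bit b ↑ (2 ^ d) ∔ (x · r) ↑ (2 ^ d)       ≡⟨ cong₂ _∔_ (bit-frobenius d b) (↑-distrib-· x r (2 ^ d)) ⟩
    bit b ∔ x ↑ (2 ^ d) · r ↑ (2 ^ d)         ≡⟨ cong (λ z → bit b ∔ x ↑ (2 ^ d) · z) (eval-frobenius d bs x) ⟩
    bit b ∔ x ↑ (2 ^ d) · eval (map bit bs) (x ↑ (2 ^ d)) ∎
    where
    open ≡-Reasoning
    r = eval (map bit bs) x

  -- Vanishes, in a field, exactly when x ↑ (2 ^ d) ≡ x for some 1 ≤ d ≤ k.
  separator : Carrier → ℕ → Carrier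
  separator x zero    = 𝟙
  separator x (suc k) = (x ↑ (2 ^ suc k) ∔ x) · separator x k

  -- Applied to an idempotent `e`: if e X had too few conjugates in eR, then `e` would kill one
  -- factor of the separator, and so the whole product.
  separator-annihilated : ∀ e x k d → 0 < d → d ≤ k → e · (x ↑ (2 ^ d) ∔ x) ≡ 𝟘 → e · separator x k ≡ 𝟘
  separator-annihilated e x zero    (suc d) 0<d () ez
  separator-annihilated e x (suc k) d       0<d d≤k ez with m≤n⇒m<n∨m≡n d≤k
  ... | inj₁ (s≤s d≤k′) = trans
    (solve 3 (λ e y s → e :* (y :* s) := y :* (e :* s)) refl e (x ↑ (2 ^ suc k) ∔ x) (separator x k))
    (trans (cong ((x ↑ (2 ^ suc k) ∔ x) ·_) (separator-annihilated e x k d 0<d d≤k′ ez)) (zeroʳ (x ↑ (2 ^ suc k) ∔ x)))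
  ... | inj₂ refl = trans (sym (·-assoc e (x ↑ (2 ^ suc k) ∔ x) (separator x k)))
    (trans (cong (_· separator x k) ez) (zeroˡ (separator x k)))

  record IsField : Set where
    field
      𝟙≢𝟘     : 𝟙 ≢ 𝟘
      inverse : ∀ {a} → a ≢ 𝟘 → ∃ λ b → b · a ≡ 𝟙

    cancel : ∀ {a b} → a ≢ 𝟘 → a · b ≡ 𝟘 → b ≡ 𝟘
    cancel {a} {b} a≢𝟘 e with inverse a≢𝟘
    ... | c , ca≡𝟙 = begin
      b           ≡⟨ ·-identityˡ b ⟨
      𝟙 · b       ≡⟨ cong (_· b) ca≡𝟙 ⟨
      c · a · b   ≡⟨ ·-assoc c a b ⟩
      c · (a · b) ≡⟨ cong (c ·_) e ⟩
      c · 𝟘       ≡⟨ zeroʳ c ⟩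
      𝟘           ∎
      where open ≡-Reasoning

  -- Synthetic division by x + r: the quotient coefficients are the values at `r` of the successive
  -- tails.
  quotient : List Carrier → Carrier → List Carrier
  quotient []           r = []
  quotient (c ∷ [])     r = []
  quotient (c ∷ d ∷ cs) r = eval (d ∷ cs) r ∷ quotient (d ∷ cs) r

  length-quotient : ∀ c cs r → length (quotient (c ∷ cs) r) ≡ length cs
  length-quotient c []       r = refl
  length-quotient c (d ∷ cs) r = cong suc (length-quotient d cs r)

  eval-quotient : ∀ cs r x → eval cs x ≡ eval cs r ∔ (x ∔ r) · eval (quotient cs r) x
  eval-quotient [] r x = solve 2 (λ r x → con false := con false :+ (x :+ r) :* con false) refl r x
  eval-quotient (c ∷ []) r x =
    solve 3 (λ c r x → c :+ x :* con false := c :+ r :* con false :+ (x :+ r) :* con false) refl c r x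
  eval-quotient (c ∷ d ∷ cs) r x = begin
    c ∔ x · eval (d ∷ cs) x ≡⟨ cong (λ z → c ∔ x · z) (eval-quotient (d ∷ cs) r x) ⟩
    c ∔ x · (p ∔ (x ∔ r) · s)
      ≡⟨ solve 5 (λ c x r p s → c :+ x :* (p :+ (x :+ r) :* s) := c :+ r :* p :+ (x :+ r) :* (p :+ x :* s)) refl c x r p s ⟩
    c ∔ r · p ∔ (x ∔ r) · (p ∔ x · s) ∎
    where
    open ≡-Reasoning
    p = eval (d ∷ cs) r
    s = eval (quotient (d ∷ cs) r) x

  -- This concerns coefficients and not just values: the first entry of the quotient is the value of
  -- the tail at `r`, so when it vanishes the head coefficient equals the remainder, and the tail is
  -- handled recursively.
  quotient-zero : ∀ cs r → All (_≡ 𝟘) (quotient cs r) → eval cs r ≡ 𝟘 → All (_≡ 𝟘) cs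
  quotient-zero []           r _        _ = []
  quotient-zero (c ∷ [])     r _        e = trans (solve 2 (λ c r → c := c :+ r :* con false) refl c r) e ∷ []
  quotient-zero (c ∷ d ∷ cs) r (e′ ∷ z) e =
    trans (sym (∔-identityʳ c)) (trans (cong (c ∔_) (sym (trans (cong (r ·_) e′) (zeroʳ r)))) e)
      ∷ quotient-zero (d ∷ cs) r z e′

  module Roots (isField : IsField) where
    open IsField isField

    -- A list of coefficients is one longer than the formal degree, so as many distinct roots as
    -- coefficients are already too many. Dividing out a root shortens both lists by one, and the
    -- other roots remain roots of the quotient.
    root-bound : ∀ cs rs → Unique rs → All (λ r → eval cs r ≡ 𝟘) rs → length cs ≤ length rs → All (_≡ 𝟘) cs
    root-bound []       rs       u       roots    le       = []
    root-bound (c ∷ cs) (r ∷ rs) (r∉ ∷ u) (e ∷ es) (s≤s le) =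
      quotient-zero (c ∷ cs) r
        (root-bound (quotient (c ∷ cs) r) rs u (All.zipWith other (r∉ , es))
          (subst (_≤ length rs) (sym (length-quotient c cs r)) le))
        e
      where
      other : ∀ {x} → r ≢ x × eval (c ∷ cs) x ≡ 𝟘 → eval (quotient (c ∷ cs) r) x ≡ 𝟘
      other {x} (r≢x , ex) = cancel (λ x+r≡𝟘 → r≢x (sym (∔-cancel x+r≡𝟘))) (begin
        (x ∔ r) · s                     ≡⟨ ∔-identityˡ _ ⟨
        𝟘 ∔ (x ∔ r) · s                 ≡⟨ cong (_∔ (x ∔ r) · s) e ⟨
        eval (c ∷ cs) r ∔ (x ∔ r) · s   ≡⟨ eval-quotient (c ∷ cs) r x ⟨
        eval (c ∷ cs) x                 ≡⟨ ex ⟩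
        𝟘                               ∎)
        where
        open ≡-Reasoning
        s = eval (quotient (c ∷ cs) r) x

-- Enumerating a field by F₂-combinations of the powers of one element.

module Enumerate (R : Char2Ring) (isField : Char2.IsField R) (_≟R_ : DecidableEquality (Char2Ring.Carrier R)) where
  open Char2 R
  open IsField isField
  open Roots isField

  module _ (m : ℕ) (fermat : ∀ a → a ↑ (2 ^ m) ≡ a) (2≤q : 2 ≤ 2 ^ m)
           (ξ : Carrier) (conjugates : ∀ d → 0 < d → d < m → ξ ↑ (2 ^ d) ≢ ξ) where

    -- By `fermat`, raising to 2^(m - i) undoes raising to 2^i. Equal conjugates for i < j would
    -- therefore make ξ fixed by j - i Frobenius steps, which `conjugates` excludes.
    conjugate-injective : ∀ {i j} → i < j → j < m → ξ ↑ (2 ^ i) ≢ ξ ↑ (2 ^ j)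
    conjugate-injective {i} {j} i<j j<m e = conjugates (j ∸ i) (m<n⇒0<n∸m i<j) (≤-<-trans (m∸n≤m j i) j<m) (begin
      ξ ↑ (2 ^ (j ∸ i))                             ≡⟨ unroot (ξ ↑ (2 ^ (j ∸ i))) ⟨
      ((ξ ↑ (2 ^ (j ∸ i))) ↑ (2 ^ i)) ↑ (2 ^ (m ∸ i))
        ≡⟨ cong (_↑ (2 ^ (m ∸ i))) (trans (↑-2^ ξ (j ∸ i) i) (cong (λ k → ξ ↑ (2 ^ k)) (m∸n+n≡m (<⇒≤ i<j)))) ⟩
      (ξ ↑ (2 ^ j)) ↑ (2 ^ (m ∸ i))                 ≡⟨ cong (_↑ (2 ^ (m ∸ i))) e ⟨
      (ξ ↑ (2 ^ i)) ↑ (2 ^ (m ∸ i))                 ≡⟨ unroot ξ ⟩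
      ξ                                             ∎)
      where
      open ≡-Reasoning
      ↑-2^ : ∀ a c d → (a ↑ (2 ^ c)) ↑ (2 ^ d) ≡ a ↑ (2 ^ (c + d))
      ↑-2^ a c d = trans (↑-* a (2 ^ c) (2 ^ d)) (cong (a ↑_) (sym (^-distribˡ-+-* 2 c d)))
      unroot : ∀ a → (a ↑ (2 ^ i)) ↑ (2 ^ (m ∸ i)) ≡ a
      unroot a = trans (↑-2^ a i (m ∸ i))
        (trans (cong (λ k → a ↑ (2 ^ k)) (m+[n∸m]≡n (<⇒≤ (<-trans i<j j<m)))) (fermat a))

    combine : ∀ {k} → Vec Bool k → Carrier
    combine v = eval (map bit (toList v)) ξ

    combine-∔ : ∀ {k} (u v : Vec Bool k) → combine (zipWith _xor_ u v) ≡ combine u ∔ combine v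
    combine-∔ []      []      = sym (∔-identityˡ 𝟘)
    combine-∔ (b ∷ u) (c ∷ v) = begin
      bit (b xor c) ∔ ξ · combine (zipWith _xor_ u v) ≡⟨ cong₂ (λ y z → y ∔ ξ · z) (+-homo b c) (combine-∔ u v) ⟩
      bit b ∔ bit c ∔ ξ · (combine u ∔ combine v)
        ≡⟨ solve 5 (λ b c x u v → b :+ c :+ x :* (u :+ v) := b :+ x :* u :+ (c :+ x :* v)) refl (bit b) (bit c) ξ (combine u) (combine v) ⟩
      bit b ∔ ξ · combine u ∔ (bit c ∔ ξ · combine v) ∎
      where
      open ≡-Reasoning
      open import Algebra.Solver.Ring.AlmostCommutativeRing using (_-Raw-AlmostCommutative⟶_)
      open _-Raw-AlmostCommutative⟶_ homo using (+-homo)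

    -- A nontrivial relation of degree below m would have the m conjugates of ξ as roots.
    combine-kernel : ∀ (v : Vec Bool m) → combine v ≡ 𝟘 → All (_≡ 𝟘) (map bit (toList v))
    combine-kernel v e = root-bound _ (applyUpTo (λ j → ξ ↑ (2 ^ j)) m)
      (Unique.applyUpTo⁺₁ _ m conjugate-injective)
      (All.applyUpTo⁺₂ _ m λ j → trans (sym (eval-frobenius j (toList v) ξ))
        (trans (cong (_↑ (2 ^ j)) e) (bit-frobenius j false)))
      (≤-reflexive (trans (length-map bit (toList v)) (trans (Vec.length-toList v) (sym (length-applyUpTo _ m)))))

    xor-kernel : ∀ {k} (u v : Vec Bool k) → All (_≡ 𝟘) (map bit (toList (zipWith _xor_ u v))) → u ≡ v
    xor-kernel []      []      _        = refl
    xor-kernel (b ∷ u) (c ∷ v) (e ∷ es) = cong₂ _∷_ (agree b c e) (xor-kernel u v es)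
      where
      agree : ∀ b c → bit (b xor c) ≡ 𝟘 → b ≡ c
      agree false false _ = refl
      agree true  true  _ = refl
      agree false true  e = contradiction e 𝟙≢𝟘
      agree true  false e = contradiction e 𝟙≢𝟘

    combine-injective : {u v : Vec Bool m} → combine u ≡ combine v → u ≡ v
    combine-injective {u} {v} e =
      xor-kernel u v (combine-kernel (zipWith _xor_ u v) (trans (combine-∔ u v) (≡⇒∔ e)))

    monomial : ℕ → List Carrier
    monomial k = replicate k 𝟘 ++ 𝟙 ∷ []

    eval-monomial : ∀ k x → eval (monomial k) x ≡ x ↑ k
    eval-monomial zero    x = solve 1 (λ x → con true :+ x :* con false := con true) refl x
    eval-monomial (suc k) x = trans (∔-identityˡ _) (cong (x ·_) (eval-monomial k x))

    -- The polynomial x + x^q. The two explicit entries take up two exponents, whence `∸ 2`, which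
    -- is exact by `2≤q`.
    fermat-polynomial : List Carrier
    fermat-polynomial = 𝟘 ∷ 𝟙 ∷ monomial (2 ^ m ∸ 2)

    length-fermat-polynomial : length fermat-polynomial ≡ suc (2 ^ m)
    length-fermat-polynomial = begin
      2 + length (monomial (2 ^ m ∸ 2))            ≡⟨ cong (2 +_) (length-++ (replicate (2 ^ m ∸ 2) 𝟘)) ⟩
      2 + (length (replicate (2 ^ m ∸ 2) 𝟘) + 1)   ≡⟨ cong (λ k → 2 + (k + 1)) (length-replicate (2 ^ m ∸ 2)) ⟩
      2 + (2 ^ m ∸ 2 + 1)                          ≡⟨ +-assoc 2 (2 ^ m ∸ 2) 1 ⟨
      2 + (2 ^ m ∸ 2) + 1                          ≡⟨ cong (_+ 1) (m+[n∸m]≡n 2≤q) ⟩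
      2 ^ m + 1                                    ≡⟨ +-comm (2 ^ m) 1 ⟩
      suc (2 ^ m)                                  ∎
      where open ≡-Reasoning

    eval-fermat-polynomial : ∀ x → eval fermat-polynomial x ≡ 𝟘
    eval-fermat-polynomial x = begin
      𝟘 ∔ x · (𝟙 ∔ x · eval (monomial (2 ^ m ∸ 2)) x)
        ≡⟨ cong (λ z → 𝟘 ∔ x · (𝟙 ∔ x · z)) (eval-monomial (2 ^ m ∸ 2) x) ⟩
      𝟘 ∔ x · (𝟙 ∔ x · x ↑ (2 ^ m ∸ 2))
        ≡⟨ solve 2 (λ x y → con false :+ x :* (con true :+ x :* y) := x :+ x :* (x :* y)) refl x (x ↑ (2 ^ m ∸ 2)) ⟩
      x ∔ x ↑ (2 + (2 ^ m ∸ 2))                       ≡⟨ cong (λ k → x ∔ x ↑ k) (m+[n∸m]≡n 2≤q) ⟩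
      x ∔ x ↑ (2 ^ m)                                 ≡⟨ ≡⇒∔ (sym (fermat x)) ⟩
      𝟘                                               ∎
      where open ≡-Reasoning

    -- An element outside the image would be one root too many for x ^ q + x.
    combine-surjective : ∀ a → a ∈ map combine (elems (finite-Vec m))
    combine-surjective a with a ∈? map combine (elems (finite-Vec m))
      where open import Data.List.Membership.DecPropositional _≟R_ using (_∈?_)
    ... | yes a∈ = a∈
    ... | no a∉  = contradiction (All.head (All.tail zero-coefficients)) 𝟙≢𝟘
      where
      values = map combine (elems (finite-Vec m))
      zero-coefficients : All (_≡ 𝟘) fermat-polynomial
      zero-coefficients = root-bound fermat-polynomial (a ∷ values)
        (All.¬Any⇒All¬ values a∉ ∷ Unique.map⁺ combine-injective (unique (finite-Vec m)))
        (All.tabulate λ {x} _ → eval-fermat-polynomial x)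
        (≤-reflexive (trans length-fermat-polynomial
          (cong suc (sym (trans (length-map combine (elems (finite-Vec m))) (size-Vec m))))))

    finite : Finite Carrier
    finite = image (finite-Vec m) _≟R_ combine combine-injective combine-surjective

    size-finite : size finite ≡ 2 ^ m
    size-finite = trans (length-map combine (elems (finite-Vec m))) (size-Vec m)

-- Idempotents and corner rings.

module Periodic (R : Char2Ring) (_≟R_ : DecidableEquality (Char2Ring.Carrier R)) (N : ℕ)
                (period : ∀ a → Char2._↑_ R a (suc (suc N)) ≡ a) where
  open Char2 R

  -- In a product of fields this is the indicator of the components in which `a` is nonzero.
  support : Carrier → Carrier
  support a = a ↑ suc N

  support-idempotent : ∀ a → support a · support a ≡ support a
  support-idempotent a = begin
    a · a ↑ N · (a ↑ suc N)   ≡⟨ solve 3 (λ a b c → a :* b :* c := b :* (a :* c)) refl a (a ↑ N) (a ↑ suc N) ⟩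
    a ↑ N · a ↑ suc (suc N)   ≡⟨ cong (a ↑ N ·_) (period a) ⟩
    a ↑ N · a                 ≡⟨ ·-comm (a ↑ N) a ⟩
    a ↑ suc N                 ∎
    where open ≡-Reasoning

  -- The support of `a` does not cut `e` into smaller pieces. Holding for all `a`, this makes `e` a
  -- primitive idempotent, because every idempotent is its own support.
  Separates : Carrier → Carrier → Set
  Separates e a = e · support a ≡ e ⊎ e · support a ≡ 𝟘

  -- Greedy refinement: `e` is multiplied by the support of the next element unless the product is
  -- zero. Such a multiplication keeps every alternative decided before, so one pass over the list
  -- is enough.
  separating-idempotent : (as : List Carrier) (c : Carrier) → c ≢ 𝟘 → c · c ≡ c →
    ∃ λ e → e ≢ 𝟘 × e · e ≡ e × e · c ≡ e × All (Separates e) as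
  separating-idempotent []       c c≢𝟘 cc = c , c≢𝟘 , cc , cc , []
  separating-idempotent (a ∷ as) c c≢𝟘 cc
    with e , e≢𝟘 , ee , ec , sep ← separating-idempotent as c c≢𝟘 cc
    with (e · support a) ≟R 𝟘
  ... | yes es≡𝟘 = e , e≢𝟘 , ee , ec , inj₂ es≡𝟘 ∷ sep
  ... | no es≢𝟘  = e · s , es≢𝟘 ,
    trans (square e s) (cong₂ _·_ ee ss) ,
    trans (push c) (cong (_· s) ec) ,
    inj₁ (trans (·-assoc e s s) (cong (e ·_) ss)) ∷ All.map refine sep
    where
    s = support a
    ss = support-idempotent a
    square : ∀ e s → e · s · (e · s) ≡ e · e · (s · s)
    square = solve 2 (λ e s → e :* s :* (e :* s) := e :* e :* (s :* s)) refl
    push : ∀ c → e · s · c ≡ e · c · s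
    push = solve 3 (λ e s c → e :* s :* c := e :* c :* s) refl e s
    refine : ∀ {b} → Separates e b → Separates (e · s) b
    refine {b} (inj₁ x) = inj₁ (trans (push (support b)) (cong (_· s) x))
    refine {b} (inj₂ x) = inj₂ (trans (push (support b)) (trans (cong (_· s) x) (zeroˡ s)))

module Corner (R : Char2Ring) (e : Char2Ring.Carrier R) (ee : Char2Ring._·_ R e e ≡ e) where
  open Char2 R

  eR : Set
  eR = Σ Carrier λ a → e · a ≡ a

  eR-≡ : {x y : eR} → proj₁ x ≡ proj₁ y → x ≡ y
  eR-≡ {a , p} {.a , p′} refl = cong (a ,_) (uip p p′)

  corner : Char2Ring
  corner = record
    { Carrier = eR
    ; _∔_ = λ (a , p) (b , q) → a ∔ b , trans (distribˡ e a b) (cong₂ _∔_ p q)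
    ; _·_ = λ (a , p) (b , q) → a · b , trans (sym (·-assoc e a b)) (cong (_· b) p)
    ; 𝟘 = 𝟘 , zeroʳ e
    ; 𝟙 = e , ee
    ; isCommutativeRing = record
      { isRing = record
        { +-isAbelianGroup = record
          { isGroup = record
            { isMonoid = record
              { isSemigroup = record
                { isMagma = record { isEquivalence = isEquivalence ; ∙-cong = cong₂ _ }
                ; assoc = λ (a , _) (b , _) (c , _) → eR-≡ (∔-assoc a b c) }
              ; identity = (λ (a , _) → eR-≡ (∔-identityˡ a)) , (λ (a , _) → eR-≡ (∔-identityʳ a)) }
            ; inverse = (λ (a , _) → eR-≡ (∔-self a)) , (λ (a , _) → eR-≡ (∔-self a))
            ; ⁻¹-cong = id }
          ; comm = λ (a , _) (b , _) → eR-≡ (∔-comm a b) }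
        ; *-cong = cong₂ _
        ; *-assoc = λ (a , _) (b , _) (c , _) → eR-≡ (·-assoc a b c)
        ; *-identity = (λ (a , p) → eR-≡ p) , (λ (a , p) → eR-≡ (trans (·-comm a e) p))
        ; distrib = (λ (a , _) (b , _) (c , _) → eR-≡ (distribˡ a b c)) ,
                    (λ (a , _) (b , _) (c , _) → eR-≡ (distribʳ a b c)) }
      ; *-comm = λ (a , _) (b , _) → eR-≡ (·-comm a b) } }

  private module C = Char2 corner

  -- The factor `e` is there for exponent 0, where the empty product in the corner is `e` and not
  -- `𝟙`.
  corner-↑ : ∀ (x : eR) k → proj₁ (x C.↑ k) ≡ e · proj₁ x ↑ k
  corner-↑ x       zero    = sym (·-identityʳ e)
  corner-↑ (a , p) (suc k) = trans (cong (a ·_) (corner-↑ (a , p) k))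
    (solve 3 (λ a e b → a :* (e :* b) := e :* (a :* b)) refl a e (a ↑ k))

-- The group algebra F₂[X]/(Xⁿ − 1)

≡ᵇ-true : ∀ {m n} → (m ≡ᵇ n) ≡ true → m ≡ n
≡ᵇ-true {m} {n} e = ≡ᵇ⇒≡ m n (subst T (sym e) _)

≡ᵇ-refl : ∀ n → (n ≡ᵇ n) ≡ true
≡ᵇ-refl zero    = refl
≡ᵇ-refl (suc n) = ≡ᵇ-refl n

≡ᵇ-false : ∀ {m n} → m ≢ n → (m ≡ᵇ n) ≡ false
≡ᵇ-false m≢n = Bool.¬-not (m≢n ∘ ≡ᵇ-true)

module GroupAlgebra (N : ℕ) where

  V : Set
  V = Vec Bool (suc N)

  infixl 6 _⊞_
  _⊞_ : Op₂ V
  _⊞_ = zipWith _xor_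

  ∅ : V
  ∅ = Vec.replicate (suc N) false

  lookup-ext : {u v : V} → (∀ i → lookup u i ≡ lookup v i) → u ≡ v
  lookup-ext {u} {v} e = trans (sym (Vec.tabulate∘lookup u)) (trans (Vec.tabulate-cong e) (Vec.tabulate∘lookup v))

  prev : Fin (suc N) → Fin (suc N)
  prev fz     = fromℕ N
  prev (fs j) = inject₁ j

  -- Multiplication by X modulo X^(N+1) − 1.
  shift : V → V
  shift v = tabulate (lookup v ∘ prev)

  lookup-shift : ∀ v i → lookup (shift v) i ≡ lookup v (prev i)
  lookup-shift v = Vec.lookup∘tabulate (lookup v ∘ prev)

  ⊞-assoc : ∀ u v w → u ⊞ v ⊞ w ≡ u ⊞ (v ⊞ w)
  ⊞-assoc = Vec.zipWith-assoc Bool.xor-assoc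

  ⊞-comm : ∀ u v → u ⊞ v ≡ v ⊞ u
  ⊞-comm = Vec.zipWith-comm Bool.xor-comm

  ⊞-identityˡ : ∀ v → ∅ ⊞ v ≡ v
  ⊞-identityˡ = Vec.zipWith-identityˡ Bool.xor-identityˡ

  ⊞-identityʳ : ∀ v → v ⊞ ∅ ≡ v
  ⊞-identityʳ = Vec.zipWith-identityʳ Bool.xor-identityʳ

  ⊞-self : ∀ v → v ⊞ v ≡ ∅
  ⊞-self v = trans (cong (zipWith _xor_ v) (sym (Vec.map-id v))) (Vec.zipWith-inverseʳ Bool.xor-same v)

  ⊞-isSemigroup : IsSemigroup _≡_ _⊞_
  ⊞-isSemigroup = record
    { isMagma = record { isEquivalence = isEquivalence ; ∙-cong = cong₂ _⊞_ } ; assoc = ⊞-assoc }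

  ⊞-commutativeSemigroup : CommutativeSemigroup 0ℓ 0ℓ
  ⊞-commutativeSemigroup = record
    { isCommutativeSemigroup = record { isSemigroup = ⊞-isSemigroup ; comm = ⊞-comm } }

  open import Algebra.Properties.CommutativeSemigroup ⊞-commutativeSemigroup using (interchange)

  shift-⊞ : ∀ u v → shift (u ⊞ v) ≡ shift u ⊞ shift v
  shift-⊞ u v = lookup-ext λ i → begin
    lookup (shift (u ⊞ v)) i                      ≡⟨ lookup-shift (u ⊞ v) i ⟩
    lookup (u ⊞ v) (prev i)                       ≡⟨ Vec.lookup-zipWith _xor_ (prev i) u v ⟩
    lookup u (prev i) xor lookup v (prev i)       ≡⟨ cong₂ _xor_ (lookup-shift u i) (lookup-shift v i) ⟨
    lookup (shift u) i xor lookup (shift v) i     ≡⟨ Vec.lookup-zipWith _xor_ i (shift u) (shift v) ⟨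
    lookup (shift u ⊞ shift v) i                  ∎
    where open ≡-Reasoning

  shift-∅ : shift ∅ ≡ ∅
  shift-∅ = lookup-ext λ i → trans (lookup-shift ∅ i)
    (trans (Vec.lookup-replicate (prev i) false) (sym (Vec.lookup-replicate i false)))

  scale : Bool → V → V
  scale b v = if b then v else ∅

  scale-⊞ : ∀ b u v → scale b (u ⊞ v) ≡ scale b u ⊞ scale b v
  scale-⊞ true  u v = refl
  scale-⊞ false u v = sym (⊞-identityˡ ∅)

  scale-shift : ∀ b v → scale b (shift v) ≡ shift (scale b v)
  scale-shift true  v = refl
  scale-shift false v = sym shift-∅

  -- Horner evaluation at the operator shift of the polynomial with coefficients bs.
  act : ∀ {k} → Vec Bool k → V → V
  act []       v = ∅
  act (b ∷ bs) v = scale b v ⊞ shift (act bs v)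

  act-⊞ : ∀ {k} (bs : Vec Bool k) u v → act bs (u ⊞ v) ≡ act bs u ⊞ act bs v
  act-⊞ []       u v = sym (⊞-identityˡ ∅)
  act-⊞ (b ∷ bs) u v = begin
    scale b (u ⊞ v) ⊞ shift (act bs (u ⊞ v))
      ≡⟨ cong₂ _⊞_ (scale-⊞ b u v) (trans (cong shift (act-⊞ bs u v)) (shift-⊞ (act bs u) (act bs v))) ⟩
    scale b u ⊞ scale b v ⊞ (shift (act bs u) ⊞ shift (act bs v))
      ≡⟨ interchange (scale b u) (scale b v) (shift (act bs u)) (shift (act bs v)) ⟩
    scale b u ⊞ shift (act bs u) ⊞ (scale b v ⊞ shift (act bs v)) ∎
    where open ≡-Reasoning

  act-∅ : ∀ {k} (bs : Vec Bool k) → act bs ∅ ≡ ∅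
  act-∅ []           = refl
  act-∅ (true ∷ bs)  = trans (⊞-identityˡ _) (trans (cong shift (act-∅ bs)) shift-∅)
  act-∅ (false ∷ bs) = trans (⊞-identityˡ _) (trans (cong shift (act-∅ bs)) shift-∅)

  act-shift : ∀ {k} (bs : Vec Bool k) v → act bs (shift v) ≡ shift (act bs v)
  act-shift []       v = sym shift-∅
  act-shift (b ∷ bs) v = trans (cong₂ _⊞_ (scale-shift b v) (cong shift (act-shift bs v)))
    (sym (shift-⊞ (scale b v) (shift (act bs v))))

  act-scale : ∀ {k} (bs : Vec Bool k) b v → act bs (scale b v) ≡ scale b (act bs v)
  act-scale bs true  v = refl
  act-scale bs false v = act-∅ bs

  -- Both actions are polynomials in the single operator `shift`. Commutativity and associativity of
  -- the product follow from this and `act-basis`, without any convolution formula.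
  act-comm : ∀ {j k} (as : Vec Bool j) (bs : Vec Bool k) v → act as (act bs v) ≡ act bs (act as v)
  act-comm []       bs v = sym (act-∅ bs)
  act-comm (a ∷ as) bs v = begin
    scale a (act bs v) ⊞ shift (act as (act bs v)) ≡⟨ cong₂ _⊞_ (act-scale bs a v) (cong shift (act-comm bs as v)) ⟨
    act bs (scale a v) ⊞ shift (act bs (act as v)) ≡⟨ cong (act bs (scale a v) ⊞_) (act-shift bs (act as v)) ⟨
    act bs (scale a v) ⊞ act bs (shift (act as v)) ≡⟨ act-⊞ bs (scale a v) (shift (act as v)) ⟨
    act bs (scale a v ⊞ shift (act as v))          ∎
    where open ≡-Reasoning

  basis : ℕ → V
  basis k = tabulate λ i → toℕ i ≡ᵇ k

  lookup-basis : ∀ k i → lookup (basis k) i ≡ (toℕ i ≡ᵇ k)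
  lookup-basis k = Vec.lookup∘tabulate (λ i → toℕ i ≡ᵇ k)

  shift-basis : ∀ k → k < N → shift (basis k) ≡ basis (suc k)
  shift-basis k k<N = lookup-ext λ i →
    trans (lookup-shift (basis k) i) (trans (lookup-basis k (prev i)) (trans (at i) (sym (lookup-basis (suc k) i))))
    where
    at : ∀ i → (toℕ (prev i) ≡ᵇ k) ≡ (toℕ i ≡ᵇ suc k)
    at fz     = ≡ᵇ-false (λ e → <⇒≢ k<N (sym (trans (sym (toℕ-fromℕ N)) e)))
    at (fs j) = cong (_≡ᵇ k) (toℕ-inject₁ j)

  shift-basis-wrap : shift (basis N) ≡ basis 0
  shift-basis-wrap = lookup-ext λ i →
    trans (lookup-shift (basis N) i) (trans (lookup-basis N (prev i)) (trans (at i) (sym (lookup-basis 0 i))))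
    where
    at : ∀ i → (toℕ (prev i) ≡ᵇ N) ≡ (toℕ i ≡ᵇ 0)
    at fz     = trans (cong (_≡ᵇ N) (toℕ-fromℕ N)) (≡ᵇ-refl N)
    at (fs j) = ≡ᵇ-false (λ e → <⇒≢ (toℕ<n j) (trans (sym (toℕ-inject₁ j)) e))

  coefficient : ∀ {k} → Vec Bool k → ℕ → Bool
  coefficient []       i       = false
  coefficient (b ∷ bs) zero    = b
  coefficient (b ∷ bs) (suc i) = coefficient bs i

  coefficient-lookup : ∀ {k} (bs : Vec Bool k) i → coefficient bs (toℕ i) ≡ lookup bs i
  coefficient-lookup (b ∷ bs) fz     = refl
  coefficient-lookup (b ∷ bs) (fs i) = coefficient-lookup bs i

  coefficient-large : ∀ {k} (bs : Vec Bool k) i → k ≤ i → coefficient bs i ≡ false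
  coefficient-large []       i       _        = refl
  coefficient-large (b ∷ bs) (suc i) (s≤s le) = coefficient-large bs i le

  -- At most N + 1 coefficients never wrap around: position 0 of a shift receives position N of the
  -- tail's action, and the tail has at most N coefficients.
  lookup-act : ∀ {k} (bs : Vec Bool k) → k ≤ suc N → ∀ i → lookup (act bs (basis 0)) i ≡ coefficient bs (toℕ i)
  lookup-act []       _        i = Vec.lookup-replicate i false
  lookup-act {suc k} (b ∷ bs) (s≤s le) i = begin
    lookup (scale b (basis 0) ⊞ shift r) i              ≡⟨ Vec.lookup-zipWith _xor_ i (scale b (basis 0)) (shift r) ⟩
    lookup (scale b (basis 0)) i xor lookup (shift r) i
      ≡⟨ cong₂ _xor_ (head-part b i) (trans (lookup-shift r i) (lookup-act bs (m≤n⇒m≤1+n le) (prev i))) ⟩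
    (b ∧ (toℕ i ≡ᵇ 0)) xor coefficient bs (toℕ (prev i)) ≡⟨ at i ⟩
    coefficient (b ∷ bs) (toℕ i)                        ∎
    where
    open ≡-Reasoning
    r = act bs (basis 0)
    head-part : ∀ b i → lookup (scale b (basis 0)) i ≡ b ∧ (toℕ i ≡ᵇ 0)
    head-part true  i = lookup-basis 0 i
    head-part false i = Vec.lookup-replicate i false
    at : ∀ i → (b ∧ (toℕ i ≡ᵇ 0)) xor coefficient bs (toℕ (prev i)) ≡ coefficient (b ∷ bs) (toℕ i)
    at fz     = trans (cong₂ _xor_ (Bool.∧-identityʳ b)
      (coefficient-large bs _ (subst (k ≤_) (sym (toℕ-fromℕ N)) le))) (Bool.xor-identityʳ b)
    at (fs j) = cong₂ _xor_ (Bool.∧-zeroʳ b) (cong (coefficient bs) (toℕ-inject₁ j))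

  act-basis : ∀ (v : V) → act v (basis 0) ≡ v
  act-basis v = lookup-ext λ i → trans (lookup-act v ≤-refl i) (coefficient-lookup v i)

  mul-comm : ∀ (u v : V) → act u v ≡ act v u
  mul-comm u v = begin
    act u v                   ≡⟨ cong (act u) (act-basis v) ⟨
    act u (act v (basis 0))   ≡⟨ act-comm u v (basis 0) ⟩
    act v (act u (basis 0))   ≡⟨ cong (act v) (act-basis u) ⟩
    act v u                   ∎
    where open ≡-Reasoning

  mul-assoc : ∀ (u v w : V) → act (act u v) w ≡ act u (act v w)
  mul-assoc u v w = begin
    act (act u v) w ≡⟨ mul-comm (act u v) w ⟩
    act w (act u v) ≡⟨ act-comm w u v ⟩
    act u (act w v) ≡⟨ cong (act u) (mul-comm w v) ⟩
    act u (act v w) ∎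
    where open ≡-Reasoning

  algebra : Char2Ring
  algebra = record
    { Carrier = V ; _∔_ = _⊞_ ; _·_ = act ; 𝟘 = ∅ ; 𝟙 = basis 0
    ; isCommutativeRing = record
      { isRing = record
        { +-isAbelianGroup = record
          { isGroup = record
            { isMonoid = record
              { isSemigroup = ⊞-isSemigroup
              ; identity = ⊞-identityˡ , ⊞-identityʳ }
            ; inverse = ⊞-self , ⊞-self
            ; ⁻¹-cong = id }
          ; comm = ⊞-comm }
        ; *-cong = cong₂ act
        ; *-assoc = mul-assoc
        ; *-identity = (λ v → trans (mul-comm (basis 0) v) (act-basis v)) , act-basis
        ; distrib = act-⊞ , λ u v w → trans (mul-comm (v ⊞ w) u)
            (trans (act-⊞ u v w) (cong₂ _⊞_ (mul-comm u v) (mul-comm u w))) }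
      ; *-comm = mul-comm } }

  open Char2 algebra

  X : V
  X = shift 𝟙

  X· : ∀ v → X · v ≡ shift v
  X· v = trans (mul-comm X v) (trans (act-shift v 𝟙) (cong shift (act-basis v)))

  X↑ : ∀ k → k ≤ N → X ↑ k ≡ basis k
  X↑ zero    _   = refl
  X↑ (suc k) k<N = trans (X· (X ↑ k)) (trans (cong shift (X↑ k (<⇒≤ k<N))) (shift-basis k k<N))

  X-order : X ↑ suc N ≡ 𝟙
  X-order = trans (X· (X ↑ N)) (trans (cong shift (X↑ N ≤-refl)) shift-basis-wrap)

  module _ (m : ℕ) (q≡ : 2 ^ m ≡ suc (suc N)) where

    X-fermat : X ↑ (2 ^ m) ≡ X
    X-fermat = trans (cong (X ↑_) q≡) (trans (cong (X ·_) X-order) (·-identityʳ X))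

    -- Since Frobenius is a ring homomorphism, it is enough that it fixes the bits and X. It fixes X
    -- because X^(N + 1) = 1 and q = N + 2.
    act-fermat : ∀ {k} (bs : Vec Bool k) → act bs 𝟙 ↑ (2 ^ m) ≡ act bs 𝟙
    act-fermat []       = bit-frobenius m false
    act-fermat (b ∷ bs) = begin
      (bit b ∔ shift r) ↑ (2 ^ m)                 ≡⟨ frobenius m (bit b) (shift r) ⟩
      bit b ↑ (2 ^ m) ∔ shift r ↑ (2 ^ m)         ≡⟨ cong₂ _∔_ (bit-frobenius m b) (cong (_↑ (2 ^ m)) (sym (X· r))) ⟩
      bit b ∔ (X · r) ↑ (2 ^ m)                   ≡⟨ cong (bit b ∔_) (↑-distrib-· X r (2 ^ m)) ⟩
      bit b ∔ X ↑ (2 ^ m) · r ↑ (2 ^ m)           ≡⟨ cong₂ (λ y z → bit b ∔ y · z) X-fermat (act-fermat bs) ⟩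
      bit b ∔ X · r                               ≡⟨ cong (bit b ∔_) (X· r) ⟩
      bit b ∔ shift r                             ∎
      where
      open ≡-Reasoning
      r = act bs 𝟙

    fermat : ∀ a → a ↑ (2 ^ m) ≡ a
    fermat a = subst (λ z → z ↑ (2 ^ m) ≡ z) (act-basis a) (act-fermat a)

  -- Both conditions are vacuous for k > N, so multiplication by X needs no degree bound, even if it
  -- wraps around; the bound is demanded only in `Monic-nonzero`.
  record Monic (k : ℕ) (v : V) : Set where
    constructor monic
    field
      top   : ∀ i → toℕ i ≡ k → lookup v i ≡ true
      above : ∀ i → k < toℕ i → lookup v i ≡ false

  Monic-X· : ∀ {k v} → Monic k v → Monic (suc k) (X · v)
  Monic-X· {k} {v} (monic top above) = subst (Monic (suc k)) (sym (X· v)) (monic top′ above′)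
    where
    top′ : ∀ i → toℕ i ≡ suc k → lookup (shift v) i ≡ true
    top′ (fs j) e = trans (lookup-shift v (fs j)) (top (inject₁ j) (trans (toℕ-inject₁ j) (suc-injective e)))
    above′ : ∀ i → suc k < toℕ i → lookup (shift v) i ≡ false
    above′ (fs j) (s≤s lt) = trans (lookup-shift v (fs j)) (above (inject₁ j) (subst (k <_) (sym (toℕ-inject₁ j)) lt))

  Monic-X↑· : ∀ j {k v} → Monic k v → Monic (j + k) (X ↑ j · v)
  Monic-X↑· zero    {v = v} mon = subst (Monic _) (sym (·-identityˡ v)) mon
  Monic-X↑· (suc j) {v = v} mon = subst (Monic _) (sym (·-assoc X (X ↑ j) v)) (Monic-X· (Monic-X↑· j mon))

  Monic-∔ : ∀ {j k u v} → j < k → Monic k u → Monic j v → Monic k (u ∔ v)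
  Monic-∔ {u = u} {v} j<k (monic topᵤ aboveᵤ) (monic topᵥ aboveᵥ) = monic
    (λ { i refl → trans (Vec.lookup-zipWith _xor_ i u v) (cong₂ _xor_ (topᵤ i refl) (aboveᵥ i j<k)) })
    (λ i lt → trans (Vec.lookup-zipWith _xor_ i u v) (cong₂ _xor_ (aboveᵤ i lt) (aboveᵥ i (<-trans j<k lt))))

  Monic-𝟙 : Monic 0 𝟙
  Monic-𝟙 = monic (λ i e → trans (lookup-basis 0 i) (cong (_≡ᵇ 0) e))
            (λ i lt → trans (lookup-basis 0 i) (≡ᵇ-false (λ e → <⇒≢ lt (sym e))))

  Monic-nonzero : ∀ {k v} → k ≤ N → Monic k v → v ≢ 𝟘
  Monic-nonzero k≤N (monic top _) refl =
    contradiction (trans (sym (top i (toℕ-fromℕ< (s≤s k≤N)))) (Vec.lookup-replicate i false)) λ ()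
    where i = fromℕ< (s≤s k≤N)

  degree-separator : ℕ → ℕ
  degree-separator zero    = 0
  degree-separator (suc k) = 2 ^ suc k + degree-separator k

  -- The geometric sum 2 + 4 + ... + 2^k. For k = m - 1 the degree is q - 2 = N, the last exponent
  -- available before X wraps around.
  degree-separator-+2 : ∀ k → degree-separator k + 2 ≡ 2 ^ suc k
  degree-separator-+2 zero    = refl
  degree-separator-+2 (suc k) = begin
    2 ^ suc k + degree-separator k + 2   ≡⟨ +-assoc (2 ^ suc k) (degree-separator k) 2 ⟩
    2 ^ suc k + (degree-separator k + 2) ≡⟨ cong (2 ^ suc k +_) (degree-separator-+2 k) ⟩
    2 ^ suc k + 2 ^ suc k                ≡⟨ cong (2 ^ suc k +_) (+-identityʳ (2 ^ suc k)) ⟨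
    2 ^ suc (suc k)                      ∎
    where open ≡-Reasoning

  Monic-separator : ∀ k → Monic (degree-separator k) (separator X k)
  Monic-separator zero    = Monic-𝟙
  Monic-separator (suc k) = subst (Monic _) (sym (distribʳ (separator X k) (X ↑ (2 ^ suc k)) X))
    (Monic-∔ (+-monoˡ-< (degree-separator k) (^-monoʳ-< 2 (s≤s (s≤s z≤n)) (s≤s (z≤n {k}))))
      (Monic-X↑· (2 ^ suc k) (Monic-separator k)) (Monic-X· (Monic-separator k)))

-- Finite fields

record GaloisField (q : ℕ) : Set₁ where
  field
    ring    : Char2Ring
    isField : Char2.IsField ring
    finite  : Finite (Char2Ring.Carrier ring)
    order   : size finite ≡ q
  open Char2 ring public
  open IsField isField public
  field
    -- Surjectivity of squaring is what solves a quadratic equation without linear term.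
    sqrt    : ∀ a → ∃ λ b → b · b ≡ a

module Split (R : Char2Ring) (finite-R : Finite (Char2Ring.Carrier R)) (X : Char2Ring.Carrier R) (k N : ℕ)
             (q≡ : 2 ^ suc (suc k) ≡ suc (suc N))
             (fermat : ∀ a → Char2._↑_ R a (2 ^ suc (suc k)) ≡ a)
             (P≢𝟘 : Char2.separator R X (suc k) ≢ Char2Ring.𝟘 R) where
  open Char2 R

  m : ℕ
  m = suc (suc k)

  2≤q : 2 ≤ 2 ^ m
  2≤q = ^-monoʳ-≤ 2 {1} {m} (s≤s z≤n)

  _≟R_ : DecidableEquality Carrier
  _≟R_ = _≟_ finite-R

  period : ∀ a → a ↑ suc (suc N) ≡ a
  period a = subst (λ j → a ↑ j ≡ a) q≡ (fermat a)

  open Periodic R _≟R_ N period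

  P : Carrier
  P = separator X (suc k)

  ·-support : ∀ a → a · support a ≡ a
  ·-support = period

  -- The start `support P` is nonzero because P · support P = P. Beginning there keeps `e` below the
  -- support of `P`, which makes e P invertible in eR.
  idempotent : ∃ λ e → e ≢ 𝟘 × e · e ≡ e × e · support P ≡ e × All (Separates e) (elems finite-R)
  idempotent = separating-idempotent (elems finite-R) (support P)
    (λ s≡𝟘 → P≢𝟘 (trans (sym (·-support P)) (trans (cong (P ·_) s≡𝟘) (zeroʳ P)))) (support-idempotent P)

  e : Carrier
  e = proj₁ idempotent

  e≢𝟘 : e ≢ 𝟘
  e≢𝟘 = proj₁ (proj₂ idempotent)

  ee : e · e ≡ e
  ee = proj₁ (proj₂ (proj₂ idempotent))

  eP : e · support P ≡ e
  eP = proj₁ (proj₂ (proj₂ (proj₂ idempotent)))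

  separates : ∀ a → Separates e a
  separates a = All.lookup (proj₂ (proj₂ (proj₂ (proj₂ idempotent)))) (complete finite-R a)

  open Corner R e ee
  module C = Char2 corner

  ξ : eR
  ξ = e · X , trans (sym (·-assoc e e X)) (cong (_· X) ee)

  -- For a in eR, a = a · support a. If `e` kills the support, then a is zero; otherwise e · support
  -- a = e, which says that e · a^N is an inverse.
  isField : C.IsField
  isField = record { 𝟙≢𝟘 = λ z → e≢𝟘 (cong proj₁ z) ; inverse = inverse }
    where
    vanish : ∀ a → e · a ≡ a → e · support a ≡ 𝟘 → a ≡ 𝟘
    vanish a ea es = begin
      a                   ≡⟨ ·-support a ⟨
      a · support a       ≡⟨ cong (_· support a) ea ⟨
      e · a · support a   ≡⟨ solve 3 (λ e a s → e :* a :* s := a :* (e :* s)) refl e a (support a) ⟩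
      a · (e · support a) ≡⟨ cong (a ·_) es ⟩
      a · 𝟘               ≡⟨ zeroʳ a ⟩
      𝟘                   ∎
      where open ≡-Reasoning
    invert : ∀ a → e · support a ≡ e → e · a ↑ N · a ≡ e
    invert a es = trans (solve 3 (λ e b a → e :* b :* a := e :* (a :* b)) refl e (a ↑ N) a) es
    inverse-from : (x : eR) → x ≢ C.𝟘 → Separates e (proj₁ x) → ∃ λ y → y C.· x ≡ C.𝟙
    inverse-from (a , ea) x≢𝟘 (inj₁ es) =
      (e · a ↑ N , trans (sym (·-assoc e e (a ↑ N))) (cong (_· a ↑ N) ee)) , eR-≡ (invert a es)
    inverse-from (a , ea) x≢𝟘 (inj₂ es) = contradiction (eR-≡ (vanish a ea es)) x≢𝟘
    inverse : ∀ {x : eR} → x ≢ C.𝟘 → ∃ λ y → y C.· x ≡ C.𝟙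
    inverse {x} x≢𝟘 = inverse-from x x≢𝟘 (separates (proj₁ x))

  fermat-corner : ∀ x → x C.↑ (2 ^ m) ≡ x
  fermat-corner (a , ea) = eR-≡ (trans (corner-↑ (a , ea) (2 ^ m)) (trans (cong (e ·_) (fermat a)) ea))

  -- If ξ were fixed, `e` would kill a factor of `P`, hence `P` and its support. As `e` lies below
  -- that support, `e` itself would be zero.
  conjugates : ∀ d → 0 < d → d < m → ξ C.↑ (2 ^ d) ≢ ξ
  conjugates d 0<d (s≤s d≤) fixed = e≢𝟘 (begin
    e               ≡⟨ eP ⟨
    e · (P · P ↑ N) ≡⟨ ·-assoc e P (P ↑ N) ⟨
    e · P · P ↑ N   ≡⟨ cong (_· P ↑ N) (separator-annihilated e X (suc k) d 0<d d≤ killed) ⟩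
    𝟘 · P ↑ N       ≡⟨ zeroˡ (P ↑ N) ⟩
    𝟘               ∎)
    where
    open ≡-Reasoning
    e-↑ : ∀ j → 0 < j → e ↑ j ≡ e
    e-↑ (suc zero)    _ = ·-identityʳ e
    e-↑ (suc (suc j)) _ = trans (cong (e ·_) (e-↑ (suc j) (s≤s z≤n))) ee
    killed : e · (X ↑ (2 ^ d) ∔ X) ≡ 𝟘
    killed = trans (distribˡ e (X ↑ (2 ^ d)) X) (≡⇒∔ (begin
      e · X ↑ (2 ^ d)                   ≡⟨ cong (_· X ↑ (2 ^ d)) ee ⟨
      e · e · X ↑ (2 ^ d)               ≡⟨ ·-assoc e e (X ↑ (2 ^ d)) ⟩
      e · (e · X ↑ (2 ^ d))             ≡⟨ cong (λ z → e · (z · X ↑ (2 ^ d))) (e-↑ (2 ^ d) (m^n>0 2 d)) ⟨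
      e · (e ↑ (2 ^ d) · X ↑ (2 ^ d))   ≡⟨ cong (e ·_) (↑-distrib-· e X (2 ^ d)) ⟨
      e · (e · X) ↑ (2 ^ d)             ≡⟨ corner-↑ ξ (2 ^ d) ⟨
      proj₁ (ξ C.↑ (2 ^ d))             ≡⟨ cong proj₁ fixed ⟩
      e · X                             ∎))

  module E = Enumerate corner isField (λ x y → map′ eR-≡ (cong proj₁) (proj₁ x ≟R proj₁ y))

  galoisField : GaloisField (2 ^ m)
  galoisField = record
    { ring = corner ; isField = isField ; finite = E.finite m fermat-corner 2≤q ξ conjugates
    ; order = E.size-finite m fermat-corner 2≤q ξ conjugates
    -- The inverse of squaring is raising to 2^(m - 1), where m - 1 is `suc k`.
    ; sqrt = λ a → a C.↑ (2 ^ suc k) , trans (sym (C.↑-+ a (2 ^ suc k) (2 ^ suc k)))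
        (trans (cong (λ j → a C.↑ (2 ^ suc k + j)) (sym (+-identityʳ (2 ^ suc k)))) (fermat-corner a)) }

galoisField : ∀ m → 2 ≤ m → GaloisField (2 ^ m)
galoisField (suc zero) (s≤s ())
galoisField (suc (suc k)) _ = Split.galoisField algebra (finite-Vec (suc N)) X k N q≡ (fermat (suc (suc k)) q≡)
  (Monic-nonzero (≤-reflexive degree≡N) (Monic-separator (suc k)))
  where
  -- Vectors of `GroupAlgebra N` have N + 1 entries, and this number is to be q - 1.
  N = 2 ^ suc (suc k) ∸ 2
  2≤q : 2 ≤ 2 ^ suc (suc k)
  2≤q = ^-monoʳ-≤ 2 {1} {suc (suc k)} (s≤s z≤n)
  q≡ : 2 ^ suc (suc k) ≡ suc (suc N)
  q≡ = sym (m+[n∸m]≡n 2≤q)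
  open GroupAlgebra N
  degree≡N : degree-separator (suc k) ≡ N
  degree≡N = +-cancelʳ-≡ 2 (degree-separator (suc k)) N
    (trans (degree-separator-+2 (suc k)) (sym (m∸n+n≡m 2≤q)))

-- The hyperoval code

δ-⊗ : {A B : Set} (FA : Finite A) (FB : Finite B) → ∀ a b a′ b′ →
      δ (FA ⊗ FB) (a , b) (a′ , b′) ≡ δ FA a a′ * δ FB b b′
δ-⊗ FA FB a b a′ b′ with _≟_ FA a a′
... | yes refl = sym (+-identityʳ _)
... | no _     = refl

δ-distinct : {A : Set} (FA : Finite A) → ∀ {a b} → a ≢ b → ∀ c → δ FA c a + δ FA c b ≤ 1
δ-distinct FA {a} {b} a≢b c with _≟_ FA c a | _≟_ FA c b
... | yes refl | yes refl = contradiction refl a≢b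
... | yes _    | no _     = s≤s z≤n
... | no _     | yes _    = s≤s z≤n
... | no _     | no _     = z≤n

module Others {A : Set} (FA : Finite A) {a b : A} (a≢b : a ≢ b) where

  -- The indicator of the complement of {a, b}; by `δ-distinct` the truncated subtraction loses
  -- nothing.
  outside : A → ℕ
  outside c = 1 ∸ (δ FA c a + δ FA c b)

  ∑-outside : ∑ (elems FA) outside + 2 ≡ size FA
  ∑-outside = begin
    ∑ (elems FA) outside + (1 + 1) ≡⟨ cong (∑ (elems FA) outside +_) (cong₂ _+_ (∑-δ FA a) (∑-δ FA b)) ⟨
    ∑ (elems FA) outside + (∑ (elems FA) (λ c → δ FA c a) + ∑ (elems FA) (λ c → δ FA c b))
      ≡⟨ cong (∑ (elems FA) outside +_) (∑-+ (elems FA) _ _) ⟨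
    ∑ (elems FA) outside + ∑ (elems FA) (λ c → δ FA c a + δ FA c b) ≡⟨ ∑-+ (elems FA) outside _ ⟨
    ∑ (elems FA) (λ c → outside c + (δ FA c a + δ FA c b)) ≡⟨ ∑-cong (elems FA) (λ c → m∸n+n≡m (δ-distinct FA a≢b c)) ⟩
    ∑ (elems FA) (λ _ → 1) ≡⟨ ∑-one (elems FA) ⟩
    size FA ∎
    where open ≡-Reasoning

  third : 2 < size FA → ∃ λ c → c ≢ a × c ≢ b
  third 2<n with c , pos ← ∑-positive (elems FA) outside (+-cancelʳ-< 2 0 _ (subst (2 <_) (sym ∑-outside) 2<n)) =
    c , (λ c≡a → none (cong (_+ δ FA c b) (ι-yes (_≟_ FA c a) c≡a)) pos)
      , (λ c≡b → none (trans (cong (δ FA c a +_) (ι-yes (_≟_ FA c b) c≡b)) (+-comm _ 1)) pos)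
    where
    none : ∀ {k n} → k ≡ suc n → ¬ (0 < 1 ∸ k)
    none {n = zero}  refl ()
    none {n = suc _} refl ()

does⇒ : {P : Set} (d : Dec P) → does d ≡ true → P
does⇒ (yes p) _ = p

-- The interface between geometry and graph. With q = 2h this is an orthogonal array of strength 2
-- and index h, with q + 2 columns and q - 1 symbols, whose distinct rows agree in 0 or 2 columns.
-- `antipode` and `another` later provide vertices at distance 4 from a given word or place.
record Code (h : ℕ) : Set₁ where
  infixl 8 _!_
  field
    Word Index Symbol : Set
    words             : Finite Word
    indices           : Finite Index
    symbols           : Finite Symbol
    _!_               : Word → Index → Symbol

  agreements : Word → Word → ℕ
  agreements x y = ∑ (elems indices) λ i → δ symbols (x ! i) (y ! i)

  field
    size-indices : size indices ≡ h + h + 2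
    size-symbols : size symbols + 1 ≡ h + h
    agreements-0∨2 : ∀ {x y} → x ≢ y → agreements x y ≡ 0 ⊎ agreements x y ≡ 2
    strength       : ∀ {i j} → i ≢ j → ∀ s t →
                     ∑ (elems words) (λ x → δ symbols (x ! i) s * δ symbols (x ! j) t) ≡ h
    antipode       : ∀ x → ∃ λ y → ∀ i → x ! i ≢ y ! i
    another        : ∀ (s : Symbol) → ∃ λ t → s ≢ t
    i₀ i₁          : Index
    i₀≢i₁          : i₀ ≢ i₁
    s₀             : Symbol

module Hyperoval (h : ℕ) (2<q : 2 < h + h) (F : GaloisField (h + h)) where
  open GaloisField F

  _≟F_ : DecidableEquality Carrier
  _≟F_ = _≟_ finite

  [_≡𝟘] : Carrier → ℕ
  [ a ≡𝟘] = δ finite a 𝟘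

  -- Roots of polynomials of degree at most 2 in characteristic 2.

  quadratic : Carrier → Carrier → Carrier → Carrier → Carrier
  quadratic x y z t = x ∔ t · y ∔ t · t · z

  roots : Carrier → Carrier → Carrier → ℕ
  roots x y z = ∑ (elems finite) λ t → [ quadratic x y z t ≡𝟘]

  roots-constant : ∀ {x} → x ≢ 𝟘 → roots x 𝟘 𝟘 ≡ 0
  roots-constant {x} x≢𝟘 = ∑-zero (elems finite) λ t → ι-no (quadratic x 𝟘 𝟘 t ≟F 𝟘) λ e →
    x≢𝟘 (trans (solve 2 (λ x t → x := x :+ t :* con false :+ t :* t :* con false) refl x t) e)

  roots-linear : ∀ {x y} → y ≢ 𝟘 → roots x y 𝟘 ≡ 1
  roots-linear {x} {y} y≢𝟘 with c , cy ← inverse y≢𝟘 =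
    ∑-unique finite (λ t → quadratic x y 𝟘 t ≟F 𝟘) (c · x) root only
    where
    open ≡-Reasoning
    root : quadratic x y 𝟘 (c · x) ≡ 𝟘
    root = begin
      quadratic x y 𝟘 (c · x)
        ≡⟨ solve 3 (λ x y c → x :+ c :* x :* y :+ c :* x :* (c :* x) :* con false := x :+ c :* y :* x) refl x y c ⟩
      x ∔ c · y · x           ≡⟨ cong (λ z → x ∔ z · x) cy ⟩
      x ∔ 𝟙 · x               ≡⟨ solve 1 (λ x → x :+ con true :* x := con false) refl x ⟩
      𝟘                       ∎
    only : ∀ t → quadratic x y 𝟘 t ≡ 𝟘 → t ≡ c · x
    only t e = ∔-cancel (begin
      t ∔ c · x                                 ≡⟨ cong (_∔ c · x) (·-identityˡ t) ⟨
      𝟙 · t ∔ c · x                             ≡⟨ cong (λ z → z · t ∔ c · x) cy ⟨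
      c · y · t ∔ c · x
        ≡⟨ solve 4 (λ x y c t → c :* y :* t :+ c :* x := c :* (x :+ t :* y :+ t :* t :* con false)) refl x y c t ⟩
      c · quadratic x y 𝟘 t                     ≡⟨ cong (c ·_) e ⟩
      c · 𝟘                                     ≡⟨ zeroʳ c ⟩
      𝟘                                         ∎)

  square-zero : ∀ {a} → a · a ≡ 𝟘 → a ≡ 𝟘
  square-zero {a} e with a ≟F 𝟘
  ... | yes a≡𝟘 = a≡𝟘
  ... | no a≢𝟘  = cancel a≢𝟘 e

  -- The equation is t² = x / z. A solution exists by `sqrt`, and it is unique because t² + r² = (t
  -- + r)².
  roots-square : ∀ {x z} → z ≢ 𝟘 → roots x 𝟘 z ≡ 1
  roots-square {x} {z} z≢𝟘 with c , cz ← inverse z≢𝟘 with r , rr ← sqrt (c · x) =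
    ∑-unique finite (λ t → quadratic x 𝟘 z t ≟F 𝟘) r root only
    where
    open ≡-Reasoning
    root : quadratic x 𝟘 z r ≡ 𝟘
    root = begin
      x ∔ r · 𝟘 ∔ r · r · z     ≡⟨ cong (λ y → x ∔ r · 𝟘 ∔ y · z) rr ⟩
      x ∔ r · 𝟘 ∔ c · x · z
        ≡⟨ solve 4 (λ x r c z → x :+ r :* con false :+ c :* x :* z := x :+ c :* z :* x) refl x r c z ⟩
      x ∔ c · z · x             ≡⟨ cong (λ y → x ∔ y · x) cz ⟩
      x ∔ 𝟙 · x                 ≡⟨ solve 1 (λ x → x :+ con true :* x := con false) refl x ⟩
      𝟘                         ∎
    only : ∀ t → quadratic x 𝟘 z t ≡ 𝟘 → t ≡ r
    only t e = ∔-cancel (square-zero (begin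
      (t ∔ r) · (t ∔ r)           ≡⟨ solve 2 (λ t r → (t :+ r) :* (t :+ r) := con true :* (t :* t) :+ r :* r) refl t r ⟩
      𝟙 · (t · t) ∔ r · r         ≡⟨ cong₂ (λ u v → u · (t · t) ∔ v) (sym cz) rr ⟩
      c · z · (t · t) ∔ c · x
        ≡⟨ solve 4 (λ x z c t → c :* z :* (t :* t) :+ c :* x := c :* (x :+ t :* con false :+ t :* t :* z)) refl x z c t ⟩
      c · quadratic x 𝟘 z t       ≡⟨ cong (c ·_) e ⟩
      c · 𝟘                       ≡⟨ zeroʳ c ⟩
      𝟘                           ∎))

  -- A root t₀ factors the polynomial as (t + t₀)(y + (t + t₀) z). The second factor gives the root
  -- t₀ + y / z, different from t₀ since y is nonzero.
  roots-quadratic : ∀ {x y z} → y ≢ 𝟘 → z ≢ 𝟘 → roots x y z ≡ 0 ⊎ roots x y z ≡ 2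
  roots-quadratic {x} {y} {z} y≢𝟘 z≢𝟘 with roots x y z in eq
  ... | zero  = inj₁ refl
  ... | suc n with t₀ , pos ← ∑-positive (elems finite) (λ t → [ quadratic x y z t ≡𝟘])
                  (subst (0 <_) (sym eq) (s≤s z≤n))
    with quadratic x y z t₀ ≟F 𝟘
  ... | yes e₀ = inj₂ (trans (sym eq) (trans (∑-cong (elems finite) pointwise)
      (trans (∑-+ (elems finite) _ _) (cong₂ _+_ (∑-δ finite t₀) (∑-δ finite t₁)))))
    where
    open ≡-Reasoning
    c = proj₁ (inverse z≢𝟘)
    cz : c · z ≡ 𝟙
    cz = proj₂ (inverse z≢𝟘)
    t₁ : Carrier
    t₁ = t₀ ∔ c · y

    difference : ∀ t → (t ∔ t₀) · (y ∔ (t ∔ t₀) · z) ≡ quadratic x y z t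
    difference t = begin
      (t ∔ t₀) · (y ∔ (t ∔ t₀) · z)
        ≡⟨ solve 5 (λ x y z t t₀ → (t :+ t₀) :* (y :+ (t :+ t₀) :* z) :=
                (x :+ t :* y :+ t :* t :* z) :+ (x :+ t₀ :* y :+ t₀ :* t₀ :* z)) refl x y z t t₀ ⟩
      quadratic x y z t ∔ quadratic x y z t₀ ≡⟨ cong (quadratic x y z t ∔_) e₀ ⟩
      quadratic x y z t ∔ 𝟘                  ≡⟨ ∔-identityʳ _ ⟩
      quadratic x y z t                      ∎

    e₁ : quadratic x y z t₁ ≡ 𝟘
    e₁ = begin
      quadratic x y z t₁                                  ≡⟨ difference t₁ ⟨
      (t₀ ∔ c · y ∔ t₀) · (y ∔ (t₀ ∔ c · y ∔ t₀) · z)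
        ≡⟨ solve 4 (λ t₀ c y z → (t₀ :+ c :* y :+ t₀) :* (y :+ (t₀ :+ c :* y :+ t₀) :* z) := c :* y :* (y :+ c :* z :* y)) refl t₀ c y z ⟩
      c · y · (y ∔ c · z · y)                             ≡⟨ cong (λ u → c · y · (y ∔ u · y)) cz ⟩
      c · y · (y ∔ 𝟙 · y)
        ≡⟨ solve 2 (λ c y → c :* y :* (y :+ con true :* y) := con false) refl c y ⟩
      𝟘                                                   ∎

    t₀≢t₁ : t₀ ≢ t₁
    t₀≢t₁ e = y≢𝟘 (begin
      y               ≡⟨ ·-identityˡ y ⟨
      𝟙 · y           ≡⟨ cong (_· y) cz ⟨
      c · z · y       ≡⟨ solve 4 (λ c z y t₀ → c :* z :* y := z :* (t₀ :+ (t₀ :+ c :* y))) refl c z y t₀ ⟩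
      z · (t₀ ∔ t₁)   ≡⟨ cong (z ·_) (≡⇒∔ e) ⟩
      z · 𝟘           ≡⟨ zeroʳ z ⟩
      𝟘               ∎)

    only : ∀ t → t ≢ t₀ → quadratic x y z t ≡ 𝟘 → t ≡ t₁
    only t t≢t₀ e = ∔-cancel (begin
      t ∔ (t₀ ∔ c · y)
        ≡⟨ solve 4 (λ t t₀ c y → t :+ (t₀ :+ c :* y) := con true :* (t :+ t₀) :+ c :* y) refl t t₀ c y ⟩
      𝟙 · (t ∔ t₀) ∔ c · y                ≡⟨ cong (λ u → u · (t ∔ t₀) ∔ c · y) cz ⟨
      c · z · (t ∔ t₀) ∔ c · y
        ≡⟨ solve 4 (λ c z d y → c :* z :* d :+ c :* y := c :* (y :+ d :* z)) refl c z (t ∔ t₀) y ⟩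
      c · (y ∔ (t ∔ t₀) · z)              ≡⟨ cong (c ·_) (cancel (λ d → t≢t₀ (∔-cancel d)) (trans (difference t) e)) ⟩
      c · 𝟘                               ≡⟨ zeroʳ c ⟩
      𝟘                                   ∎)

    pointwise : ∀ t → [ quadratic x y z t ≡𝟘] ≡ δ finite t t₀ + δ finite t t₁
    pointwise t with t ≟F t₀ | t ≟F t₁
    ... | yes refl | yes e = contradiction e t₀≢t₁
    ... | yes refl | no _  = ι-yes (quadratic x y z t ≟F 𝟘) e₀
    ... | no _ | yes refl  = ι-yes (quadratic x y z t ≟F 𝟘) e₁
    ... | no t≢t₀ | no t≢t₁ = ι-no (quadratic x y z t ≟F 𝟘) (t≢t₁ ∘ only t t≢t₀)

  -- The linear forms of the hyperoval and their zeros.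

  Vector : Set
  Vector = Carrier × (Carrier × Carrier)

  vectors : Finite Vector
  vectors = finite ⊗ finite ⊗ finite

  infixl 6 _⊹_
  _⊹_ : Vector → Vector → Vector
  (x , y , z) ⊹ (x′ , y′ , z′) = x ∔ x′ , y ∔ y′ , z ∔ z′

  infixl 7 _•_
  _•_ : Carrier → Vector → Vector
  c • (x , y , z) = c · x , c · y , c · z

  𝟎 : Vector
  𝟎 = 𝟘 , 𝟘 , 𝟘

  ⊹-cancel : ∀ {u v} → u ⊹ v ≡ 𝟎 → u ≡ v
  ⊹-cancel e = cong₂ _,_ (∔-cancel (cong proj₁ e))
    (cong₂ _,_ (∔-cancel (cong (proj₁ ∘ proj₂) e)) (∔-cancel (cong (proj₂ ∘ proj₂) e)))

  -- The points (1,t,t²) of a conic, its point (0,0,1) at infinity and its nucleus (0,1,0).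
  Point : Set
  Point = Bool ⊎ Carrier

  points : Finite Point
  points = finite-Bool ⊕ finite

  form : Point → Vector → Carrier
  form (inj₁ true)  (x , y , z) = y
  form (inj₁ false) (x , y , z) = z
  form (inj₂ t)     (x , y , z) = quadratic x y z t

  form-⊹ : ∀ i u v → form i (u ⊹ v) ≡ form i u ∔ form i v
  form-⊹ (inj₁ true)  u v = refl
  form-⊹ (inj₁ false) u v = refl
  form-⊹ (inj₂ t) (x , y , z) (x′ , y′ , z′) =
    solve 7 (λ t x y z x′ y′ z′ → x :+ x′ :+ t :* (y :+ y′) :+ t :* t :* (z :+ z′) :=
             x :+ t :* y :+ t :* t :* z :+ (x′ :+ t :* y′ :+ t :* t :* z′))
      refl t x y z x′ y′ z′

  form-• : ∀ i c v → form i (c • v) ≡ c · form i v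
  form-• (inj₁ true)  c v = refl
  form-• (inj₁ false) c v = refl
  form-• (inj₂ t) c (x , y , z) =
    solve 5 (λ t c x y z → c :* x :+ t :* (c :* y) :+ t :* t :* (c :* z) :=
             c :* (x :+ t :* y :+ t :* t :* z)) refl t c x y z

  zeros : Vector → ℕ
  zeros v = ∑ (elems points) λ i → [ form i v ≡𝟘]

  zeros-split : ∀ x y z → zeros (x , y , z) ≡ [ y ≡𝟘] + ([ z ≡𝟘] + 0) + roots x y z
  zeros-split x y z = ∑-⊕ finite-Bool finite λ i → [ form i (x , y , z) ≡𝟘]

  -- A line meets a hyperoval in 0 or 2 points. The two extra points repair the degenerate
  -- quadratics: the nucleus adds a zero when y = 0, where the root is double, and the point at
  -- infinity adds one when z = 0, where the degree drops.
  zeros-0∨2 : ∀ {v} → v ≢ 𝟎 → zeros v ≡ 0 ⊎ zeros v ≡ 2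
  zeros-0∨2 {x , y , z} v≢𝟎 = subst (λ k → k ≡ 0 ⊎ k ≡ 2) (sym (zeros-split x y z)) (by-cases (y ≟F 𝟘) (z ≟F 𝟘))
    where
    by-cases : (dy : Dec (y ≡ 𝟘)) (dz : Dec (z ≡ 𝟘)) →
      let n = ι (does dy) + (ι (does dz) + 0) + roots x y z in n ≡ 0 ⊎ n ≡ 2
    by-cases (yes refl) (yes refl) = inj₂ (cong (2 +_) (roots-constant λ { refl → v≢𝟎 refl }))
    by-cases (yes refl) (no z≢𝟘)   = inj₂ (cong suc (roots-square z≢𝟘))
    by-cases (no y≢𝟘)   (yes refl) = inj₂ (cong suc (roots-linear y≢𝟘))
    by-cases (no y≢𝟘)   (no z≢𝟘)   = roots-quadratic y≢𝟘 z≢𝟘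

  -- A nonzero vector has at most two zeros, and three distinct points would each contribute one. So
  -- any three of the forms are linearly independent.
  vanish₃ : ∀ {i j k v} → i ≢ j → i ≢ k → j ≢ k → form i v ≡ 𝟘 → form j v ≡ 𝟘 → form k v ≡ 𝟘 → v ≡ 𝟎
  vanish₃ {i} {j} {k} {v} i≢j i≢k j≢k fi fj fk with _≟_ vectors v 𝟎
  ... | yes v≡𝟎 = v≡𝟎
  ... | no v≢𝟎  = ⊥-elim (too-many (zeros-0∨2 v≢𝟎))
    where
    pointwise : ∀ l → δ points l i + δ points l j + δ points l k ≤ [ form l v ≡𝟘]
    pointwise l with _≟_ points l i | _≟_ points l j | _≟_ points l k
    ... | yes refl | yes e    | _        = contradiction e i≢j
    ... | yes refl | no _     | yes e    = contradiction e i≢k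
    ... | yes refl | no _     | no _     = ≤-reflexive (sym (ι-yes (form l v ≟F 𝟘) fi))
    ... | no _     | yes refl | yes e    = contradiction e j≢k
    ... | no _     | yes refl | no _     = ≤-reflexive (sym (ι-yes (form l v ≟F 𝟘) fj))
    ... | no _     | no _     | yes refl = ≤-reflexive (sym (ι-yes (form l v ≟F 𝟘) fk))
    ... | no _     | no _     | no _     = z≤n
    3≤zeros : 3 ≤ zeros v
    3≤zeros = subst (_≤ zeros v)
      (trans (∑-+ (elems points) (λ l → δ points l i + δ points l j) (λ l → δ points l k))
        (cong₂ _+_ (trans (∑-+ (elems points) (λ l → δ points l i) (λ l → δ points l j))
          (cong₂ _+_ (∑-δ points i) (∑-δ points j))) (∑-δ points k)))
      (∑-mono (elems points) pointwise)
    too-many : zeros v ≡ 0 ⊎ zeros v ≡ 2 → ⊥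
    too-many (inj₁ e) = contradiction (subst (3 ≤_) e 3≤zeros) λ ()
    too-many (inj₂ e) = contradiction (subst (3 ≤_) e 3≤zeros) λ { (s≤s (s≤s ())) }

  [_at_is_] : Vector → Point → Carrier → ℕ
  [ v at i is s ] = δ finite (form i v) s

  -- By `vanish₃` the three forms together map the vectors injectively to triples of field elements,
  -- and there are as many triples as vectors.
  count₃ : ∀ {i j k} → i ≢ j → i ≢ k → j ≢ k → ∀ s t u →
           ∑ (elems vectors) (λ v → [ v at i is s ] * ([ v at j is t ] * [ v at k is u ])) ≡ 1
  count₃ {i} {j} {k} i≢j i≢k j≢k s t u = trans (∑-cong (elems vectors) λ v → sym (split v))
    (fibre-singleton vectors vectors values values-injective ≤-refl (s , t , u))
    where
    values : Vector → Vector
    values v = form i v , form j v , form k v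
    same : ∀ l {v w} → form l v ≡ form l w → form l (v ⊹ w) ≡ 𝟘
    same l {v} {w} e = trans (form-⊹ l v w) (≡⇒∔ e)
    values-injective : ∀ {v w} → values v ≡ values w → v ≡ w
    values-injective {v} {w} e = ⊹-cancel (vanish₃ i≢j i≢k j≢k
      (same i (cong proj₁ e)) (same j (cong (proj₁ ∘ proj₂) e)) (same k (cong (proj₂ ∘ proj₂) e)))
    split : ∀ v → δ vectors (values v) (s , t , u) ≡ [ v at i is s ] * ([ v at j is t ] * [ v at k is u ])
    split v = trans (δ-⊗ finite (finite ⊗ finite) (form i v) (form j v , form k v) s (t , u))
      (cong ([ v at i is s ] *_) (δ-⊗ finite finite (form j v) (form k v) t u))

  size-points : size points ≡ h + h + 2
  size-points = begin
    size points ≡⟨ ∑-one (elems points) ⟨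
    ∑ (elems points) (λ _ → 1)                          ≡⟨ ∑-⊕ finite-Bool finite (λ _ → 1) ⟩
    2 + ∑ (elems finite) (λ _ → 1)                      ≡⟨ cong (2 +_) (trans (∑-one (elems finite)) order) ⟩
    2 + (h + h)                                         ≡⟨ +-comm 2 (h + h) ⟩
    h + h + 2                                           ∎
    where open ≡-Reasoning

  -- The value of the form at a third point k sorts the vectors into q classes, each with exactly
  -- one element by `count₃`.
  count₂ : ∀ {i j} → i ≢ j → ∀ s t → ∑ (elems vectors) (λ v → [ v at i is s ] * [ v at j is t ]) ≡ h + h
  count₂ {i} {j} i≢j s t
    with k , k≢i , k≢j ← Others.third points i≢j (subst (2 <_) (sym size-points) (m≤n⇒m≤n+o 2 2<q)) = begin
    ∑ (elems vectors) (λ v → [ v at i is s ] * [ v at j is t ]) ≡⟨ ∑-cong (elems vectors) expand ⟨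
    ∑ (elems vectors) (λ v → ∑ (elems finite) λ u → [ v at i is s ] * ([ v at j is t ] * [ v at k is u ]))
      ≡⟨ ∑-swap (elems vectors) (elems finite) _ ⟩
    ∑ (elems finite) (λ u → ∑ (elems vectors) λ v → [ v at i is s ] * ([ v at j is t ] * [ v at k is u ]))
      ≡⟨ ∑-cong (elems finite) (count₃ i≢j (k≢i ∘ sym) (k≢j ∘ sym) s t) ⟩
    ∑ (elems finite) (λ _ → 1) ≡⟨ trans (∑-one (elems finite)) order ⟩
    h + h ∎
    where
    open ≡-Reasoning
    expand : ∀ v → ∑ (elems finite) (λ u → [ v at i is s ] * ([ v at j is t ] * [ v at k is u ])) ≡
             [ v at i is s ] * [ v at j is t ]
    expand v = trans (∑-*ˡ (elems finite) [ v at i is s ] _) (cong ([ v at i is s ] *_)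
      (trans (∑-*ˡ (elems finite) [ v at j is t ] _)
        (trans (cong ([ v at j is t ] *_) (∑-δ-sym finite (form k v))) (*-identityʳ _))))

  nowhere-zero : Vector → Bool
  nowhere-zero v = does (zeros v ℕ.≟ 0)

  -- Double counting of the pairs (v, k) with v on the line {form i = s, form j = t} and
  -- form k v = 0: each point k ∉ {i, j} contributes one pair, each v contributes 0 or 2.
  strength : ∀ {i j} → i ≢ j → ∀ {s t} → s ≢ 𝟘 → t ≢ 𝟘 →
             ∑ (elems vectors) (λ v → ι (nowhere-zero v) * ([ v at i is s ] * [ v at j is t ])) ≡ h
  strength {i} {j} i≢j {s} {t} s≢𝟘 t≢𝟘 = halve (+-cancelˡ-≡ (h + h) (S + S) (h + h) (begin
    h + h + (S + S)                   ≡⟨ cong (_+ (S + S)) incidences ⟨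
    ∑ (elems vectors) (λ v → g v * zeros v) + (S + S)
      ≡⟨ cong (∑ (elems vectors) (λ v → g v * zeros v) +_) (∑-+ (elems vectors) _ _) ⟨
    ∑ (elems vectors) (λ v → g v * zeros v) + ∑ (elems vectors) (λ v → ι (nowhere-zero v) * g v + ι (nowhere-zero v) * g v)
      ≡⟨ ∑-+ (elems vectors) _ _ ⟨
    ∑ (elems vectors) (λ v → g v * zeros v + (ι (nowhere-zero v) * g v + ι (nowhere-zero v) * g v))
      ≡⟨ ∑-cong (elems vectors) pointwise ⟩
    ∑ (elems vectors) (λ v → g v + g v) ≡⟨ ∑-+ (elems vectors) g g ⟩
    ∑ (elems vectors) g + ∑ (elems vectors) g ≡⟨ cong₂ _+_ (count₂ i≢j s t) (count₂ i≢j s t) ⟩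
    h + h + (h + h) ∎))
    where
    open ≡-Reasoning
    open Others points i≢j
    g : Vector → ℕ
    g v = [ v at i is s ] * [ v at j is t ]
    S = ∑ (elems vectors) (λ v → ι (nowhere-zero v) * g v)

    halve : ∀ {a b} → a + a ≡ b + b → a ≡ b
    halve {a} {b} e =
      *-cancelˡ-≡ a b 2 (trans (cong (a +_) (+-identityʳ a)) (trans e (cong (b +_) (sym (+-identityʳ b)))))

    incident : ∀ k → ∑ (elems vectors) (λ v → g v * [ form k v ≡𝟘]) ≡ outside k
    incident k with _≟_ points k i | _≟_ points k j
    ... | yes refl | yes refl = contradiction refl i≢j
    ... | no k≢i | no k≢j = trans (∑-cong (elems vectors) λ v → *-assoc [ v at i is s ] [ v at j is t ] _)
      (count₃ i≢j (k≢i ∘ sym) (k≢j ∘ sym) s t 𝟘)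
    ... | yes refl | no _ = ∑-zero (elems vectors) vanish
      where
      vanish : ∀ v → g v * [ form k v ≡𝟘] ≡ 0
      vanish v with form k v ≟F s | form k v ≟F 𝟘
      ... | yes e | yes e′ = contradiction (trans (sym e) e′) s≢𝟘
      ... | no _  | _      = refl
      ... | yes _ | no _   = *-zeroʳ (1 * [ v at j is t ])
    ... | no _ | yes refl = ∑-zero (elems vectors) vanish
      where
      vanish : ∀ v → g v * [ form k v ≡𝟘] ≡ 0
      vanish v with form k v ≟F t | form k v ≟F 𝟘
      ... | yes e | yes e′ = contradiction (trans (sym e) e′) t≢𝟘
      ... | no _  | d      = cong (_* ι (does d)) (*-zeroʳ [ v at i is s ])
      ... | yes _ | no _   = *-zeroʳ ([ v at i is s ] * 1)

    incidences : ∑ (elems vectors) (λ v → g v * zeros v) ≡ h + h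
    incidences = begin
      ∑ (elems vectors) (λ v → g v * zeros v) ≡⟨ ∑-cong (elems vectors) (λ v → ∑-*ˡ (elems points) (g v) _) ⟨
      ∑ (elems vectors) (λ v → ∑ (elems points) λ k → g v * [ form k v ≡𝟘]) ≡⟨ ∑-swap (elems vectors) (elems points) _ ⟩
      ∑ (elems points) (λ k → ∑ (elems vectors) λ v → g v * [ form k v ≡𝟘]) ≡⟨ ∑-cong (elems points) incident ⟩
      ∑ (elems points) outside ≡⟨ +-cancelʳ-≡ 2 _ (h + h) (trans ∑-outside size-points) ⟩
      h + h ∎

    -- A nonzero v has 0 or 2 zeros, so its zeros plus twice the indicator of having none make 2;
    -- where `g v` is positive, v is nonzero because `s` is. Summed over the line this reads 2h + 2S
    -- = 4h.
    pointwise : ∀ v → g v * zeros v + (ι (nowhere-zero v) * g v + ι (nowhere-zero v) * g v) ≡ g v + g v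
    pointwise v with form i v ≟F s
    ... | no _ = cong₂ _+_ (*-zeroʳ (ι (nowhere-zero v))) (*-zeroʳ (ι (nowhere-zero v)))
    ... | yes e = by-zeros (1 * [ v at j is t ]) (zeros-0∨2 {v} λ { refl → s≢𝟘 (trans (sym e) (form-𝟎 i)) })
      where
      form-𝟎 : ∀ i → form i 𝟎 ≡ 𝟘
      form-𝟎 (inj₁ true)  = refl
      form-𝟎 (inj₁ false) = refl
      form-𝟎 (inj₂ t)     = solve 1 (λ t → con false :+ t :* con false :+ t :* t :* con false := con false) refl t
      by-zeros : ∀ c → zeros v ≡ 0 ⊎ zeros v ≡ 2 →
        c * zeros v + (ι (nowhere-zero v) * c + ι (nowhere-zero v) * c) ≡ c + c
      by-zeros c (inj₁ z) rewrite z = cong₂ _+_ (*-zeroʳ c) (cong₂ _+_ (+-identityʳ c) (+-identityʳ c))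
      by-zeros c (inj₂ z) rewrite z = trans (+-identityʳ (c * 2)) (trans (*-comm c 2) (cong (c +_) (+-identityʳ c)))

  nonzero : Carrier → Bool
  nonzero a = not (does (a ≟F 𝟘))

  nonzero⇒≢ : ∀ {a} → nonzero a ≡ true → a ≢ 𝟘
  nonzero⇒≢ {a} p with no a≢𝟘 ← a ≟F 𝟘 = a≢𝟘

  ≢⇒nonzero : ∀ {a} → a ≢ 𝟘 → nonzero a ≡ true
  ≢⇒nonzero {a} a≢𝟘 with a ≟F 𝟘
  ... | yes a≡𝟘 = contradiction a≡𝟘 a≢𝟘
  ... | no _    = refl

  nowhere-zero⇒zeros : ∀ {v} → nowhere-zero v ≡ true → zeros v ≡ 0
  nowhere-zero⇒zeros {v} = does⇒ (zeros v ℕ.≟ 0)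

  form-nonzero : ∀ {v} → nowhere-zero v ≡ true → ∀ i → nonzero (form i v) ≡ true
  form-nonzero {v} p i = ≢⇒nonzero λ e → contradiction
    (trans (sym (ι-yes (form i v ≟F 𝟘) e))
      (n≤0⇒n≡0 (subst ([ form i v ≡𝟘] ≤_) (nowhere-zero⇒zeros p) (≤∑ points i λ i → [ form i v ≡𝟘]))))
    λ ()

  -- Multiplying by such a scalar preserves the zeros of all forms and moves every nonzero value.
  -- Its existence rests on q > 2.
  scalar : ∃ λ c → c ≢ 𝟘 × c ≢ 𝟙
  scalar = Others.third finite (𝟙≢𝟘 ∘ sym) (subst (2 <_) (sym order) 2<q)

  c₀ : Carrier
  c₀ = proj₁ scalar

  c₀·≢ : ∀ {a} → a ≢ 𝟘 → c₀ · a ≢ 𝟘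
  c₀·≢ a≢𝟘 e = a≢𝟘 (cancel (proj₁ (proj₂ scalar)) e)

  c₀-moves : ∀ {a} → a ≢ 𝟘 → a ≢ c₀ · a
  c₀-moves {a} a≢𝟘 e = a≢𝟘 (cancel {c₀ ∔ 𝟙} (λ z → proj₂ (proj₂ scalar) (∔-cancel z))
    (trans (solve 2 (λ c a → (c :+ con true) :* a := a :+ c :* a) refl c₀ a) (≡⇒∔ e)))

  code : Code h
  code = record
    { Word = Subset nowhere-zero
    ; Index = Point
    ; Symbol = Subset nonzero
    ; words = finite-Subset nowhere-zero vectors
    ; indices = points
    ; symbols = finite-Subset nonzero finite
    ; _!_ = λ (v , p) i → form i v , form-nonzero p i
    ; size-indices = size-points
    ; size-symbols = size-symbols
    ; agreements-0∨2 = λ {x} {y} x≢y → subst (λ k → k ≡ 0 ⊎ k ≡ 2) (sym (agreements-zeros (proj₁ x) (proj₁ y)))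
        (zeros-0∨2 λ e → x≢y (Subset-≡ (⊹-cancel e)))
    ; strength = λ {i} {j} i≢j s t → trans
        (∑-select nowhere-zero (elems vectors) (λ v → [ v at i is proj₁ s ] * [ v at j is proj₁ t ]))
        (strength i≢j (nonzero⇒≢ (proj₂ s)) (nonzero⇒≢ (proj₂ t)))
    ; antipode = λ (v , p) → (c₀ • v , scaled p) , λ i e →
        c₀-moves (nonzero⇒≢ (form-nonzero p i)) (trans (cong proj₁ e) (form-• i c₀ v))
    ; another = λ (s , p) → (c₀ · s , ≢⇒nonzero (c₀·≢ (nonzero⇒≢ p))) , λ e → c₀-moves (nonzero⇒≢ p) (cong proj₁ e)
    ; i₀ = inj₁ true
    ; i₁ = inj₁ false
    ; i₀≢i₁ = λ ()
    ; s₀ = 𝟙 , ≢⇒nonzero 𝟙≢𝟘 }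
    where
    agreements-zeros : ∀ u v → ∑ (elems points) (λ i → δ finite (form i u) (form i v)) ≡ zeros (u ⊹ v)
    agreements-zeros u v = ∑-cong (elems points) λ i → ι-cong (form i u ≟F form i v) (form i (u ⊹ v) ≟F 𝟘)
      (λ e → trans (form-⊹ i u v) (≡⇒∔ e)) (λ e → ∔-cancel (trans (sym (form-⊹ i u v)) e))
    scaled : ∀ {v} → nowhere-zero v ≡ true → nowhere-zero (c₀ • v) ≡ true
    scaled {v} p = trans (cong (λ n → does (n ℕ.≟ 0)) (∑-cong (elems points) λ i →
      ι-cong (form i (c₀ • v) ≟F 𝟘) (form i v ≟F 𝟘)
      (λ e → cancel (proj₁ (proj₂ scalar)) (trans (sym (form-• i c₀ v)) e))
      (λ e → trans (form-• i c₀ v) (trans (cong (c₀ ·_) e) (zeroʳ c₀))))) p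
    size-symbols : size (finite-Subset nonzero finite) + 1 ≡ h + h
    size-symbols = begin
      size (finite-Subset nonzero finite) + 1 ≡⟨ cong₂ _+_ (∑-one (select nonzero (elems finite))) (∑-δ finite 𝟘) ⟨
      ∑ (select nonzero (elems finite)) (λ _ → 1) + ∑ (elems finite) [_≡𝟘]
        ≡⟨ cong (_+ ∑ (elems finite) [_≡𝟘]) (∑-select nonzero (elems finite) (λ _ → 1)) ⟩
      ∑ (elems finite) (λ a → ι (nonzero a) * 1) + ∑ (elems finite) [_≡𝟘] ≡⟨ ∑-+ (elems finite) _ _ ⟨
      ∑ (elems finite) (λ a → ι (nonzero a) * 1 + [ a ≡𝟘]) ≡⟨ ∑-cong (elems finite) (λ a → excluded (does (a ≟F 𝟘))) ⟩
      ∑ (elems finite) (λ _ → 1) ≡⟨ trans (∑-one (elems finite)) order ⟩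
      h + h ∎
      where
      open ≡-Reasoning
      excluded : ∀ b → ι (not b) * 1 + ι b ≡ 1
      excluded true  = refl
      excluded false = refl

-- Distances in bipartite graphs

bool-ext : ∀ {b c} → (b ≡ true → c ≡ true) → (c ≡ true → b ≡ true) → b ≡ c
bool-ext {true}  {c}     f g = sym (f refl)
bool-ext {false} {true}  f g = g refl
bool-ext {false} {false} f g = refl

∧-true : ∀ {b c} → b ∧ c ≡ true → b ≡ true × c ≡ true
∧-true {true} {true} _ = refl , refl

∨-true : ∀ {b c} → b ∨ c ≡ true → b ≡ true ⊎ c ≡ true
∨-true {true}  _ = inj₁ refl
∨-true {false} e = inj₂ e

anyV⁻ : ∀ {n} (p : Fin n → Bool) → anyV p ≡ true → ∃ λ u → p u ≡ true
anyV⁻ {suc n} p e with p fz in eq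
... | true  = fz , eq
... | false with u , pu ← anyV⁻ (p ∘ fs) e = fs u , pu

anyV⁺ : ∀ {n} (p : Fin n → Bool) u → p u ≡ true → anyV p ≡ true
anyV⁺ p fz     pu rewrite pu = refl
anyV⁺ p (fs u) pu = trans (cong (p fz ∨_) (anyV⁺ (p ∘ fs) u pu)) (Bool.∨-zeroʳ (p fz))

count-cong : ∀ {n} {p p′ : Fin n → Bool} → (∀ u → p u ≡ p′ u) → count p ≡ count p′
count-cong {zero}  e = refl
count-cong {suc n} e = cong₂ _+_ (cong ι (e fz)) (count-cong (e ∘ fs))

count-lookup : {A : Set} (xs : List A) (p : A → Bool) → count (p ∘ List.lookup xs) ≡ ∑ xs (ι ∘ p)
count-lookup []       p = refl
count-lookup (x ∷ xs) p = cong (ι (p x) +_) (count-lookup xs p)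

lookup-∉ : {A : Set} {a : A} {xs : List A} → All (a ≢_) xs → ∀ u → a ≢ List.lookup xs u
lookup-∉ (a≢x ∷ _)  fz     = a≢x
lookup-∉ (_ ∷ a∉xs) (fs u) = lookup-∉ a∉xs u

lookup-injective : {A : Set} {xs : List A} → Unique xs → ∀ {u v} → List.lookup xs u ≡ List.lookup xs v → u ≡ v
lookup-injective (_ ∷ _)    {fz}   {fz}   e = refl
lookup-injective (x∉xs ∷ _) {fz}   {fs v} e = contradiction e (lookup-∉ x∉xs v)
lookup-injective (x∉xs ∷ _) {fs u} {fz}   e = contradiction (sym e) (lookup-∉ x∉xs u)
lookup-injective (_ ∷ uniq) {fs u} {fs v} e = cong fs (lookup-injective uniq e)

-- Laws that force an explicitly given function to be the graph distance: `dist-step` bounds it by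
-- the length of any walk, and `dist-pred` builds a walk of that length. `parity` is the trace of
-- bipartiteness.
record Metric (W : Set) (adj : W → W → Bool) : Set where
  field
    dist      : W → W → ℕ
    dist-self : ∀ a → dist a a ≡ 0
    dist-zero : ∀ a b → dist a b ≡ 0 → a ≡ b
    dist-step : ∀ a u b → adj u b ≡ true → dist a b ≤ suc (dist a u)
    dist-pred : ∀ a b {k} → dist a b ≡ suc k → ∃ λ u → dist a u ≡ k × adj u b ≡ true
    parity    : ∀ a u b → adj u b ≡ true → dist a u ≢ dist a b

module MetricGraph {W : Set} (vertices : Finite W) (inYW : W → Bool) (adjW : W → W → Bool)
                   (adjW-sym : ∀ u v → adjW u v ≡ adjW v u)
                   (bipartiteW : ∀ u v → adjW u v ≡ true → inYW u ≢ inYW v)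
                   (metric : Metric W adjW) where
  open Metric metric

  at : Fin (size vertices) → W
  at = List.lookup (elems vertices)

  number : W → Fin (size vertices)
  number w = index (complete vertices w)

  at-number : ∀ w → at (number w) ≡ w
  at-number w = sym (lookup-index (complete vertices w))

  graph : BipGraph
  graph = record
    { n = size vertices ; adj = λ u v → adjW (at u) (at v) ; inY = inYW ∘ at
    ; adj-sym = λ u v → adjW-sym (at u) (at v) ; bipartite = λ u v → bipartiteW (at u) (at v) }

  open BipGraph graph

  walk⇒dist : ∀ j a b → walkWithin j a b ≡ true → dist (at a) (at b) ≤ j
  walk⇒dist zero a b e with a Fin.≟ b
  ... | yes refl = ≤-reflexive (dist-self (at a))
  walk⇒dist (suc j) a b e with ∨-true {walkWithin j a b} e
  ... | inj₁ e′ = m≤n⇒m≤1+n (walk⇒dist j a b e′)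
  ... | inj₂ e′ with u , both ← anyV⁻ _ e′ with w , ub ← ∧-true {walkWithin j a u} both =
    ≤-trans (dist-step (at a) (at u) (at b) ub) (s≤s (walk⇒dist j a u w))

  dist⇒walk : ∀ j a b → dist (at a) (at b) ≤ j → walkWithin j a b ≡ true
  dist⇒walk zero a b le with a Fin.≟ b
  ... | yes _  = refl
  ... | no a≢b = contradiction
    (lookup-injective (unique vertices) (dist-zero (at a) (at b) (n≤0⇒n≡0 le))) a≢b
  dist⇒walk (suc j) a b le with m≤n⇒m<n∨m≡n le
  ... | inj₁ (s≤s le′) = cong (_∨ anyV (λ u → walkWithin j a u ∧ adj u b)) (dist⇒walk j a b le′)
  ... | inj₂ e with u , du , ub ← dist-pred (at a) (at b) e =
    trans (cong (walkWithin j a b ∨_) (anyV⁺ (λ u → walkWithin j a u ∧ adj u b) (number u)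
      (cong₂ _∧_ (dist⇒walk j a (number u) (≤-reflexive (trans (cong (dist (at a)) (at-number u)) du)))
        (trans (cong (λ w → adjW w (at b)) (at-number u)) ub))))
      (Bool.∨-zeroʳ (walkWithin j a b))

  Dist⇒ : ∀ a b i → Dist a b i → dist (at a) (at b) ≡ i
  Dist⇒ a b zero    e = n≤0⇒n≡0 (walk⇒dist zero a b e)
  Dist⇒ a b (suc i) e with w , not-w ← ∧-true {walkWithin (suc i) a b} e =
    ≤-antisym (walk⇒dist (suc i) a b w)
      (≰⇒> λ le → contradiction (trans (sym not-w) (cong not (dist⇒walk i a b le))) λ ())

  ⇒Dist : ∀ a b i → dist (at a) (at b) ≡ i → Dist a b i
  ⇒Dist a b zero    e = dist⇒walk zero a b (≤-reflexive e)
  ⇒Dist a b (suc i) e = cong₂ _∧_ (dist⇒walk (suc i) a b (≤-reflexive e))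
    (cong not (Bool.¬-not λ w → <⇒≱ (≤-reflexive (sym e)) (walk⇒dist i a b w)))

  isDist-dist : ∀ a b i → isDist a b i ≡ (dist (at a) (at b) ≡ᵇ i)
  isDist-dist a b i = bool-ext (λ e → trans (cong (_≡ᵇ i) (Dist⇒ a b i e)) (≡ᵇ-refl i)) (⇒Dist a b i ∘ ≡ᵇ-true)

  sphere : W → W → ℕ → ℕ
  sphere a w i = ∑ (elems vertices) λ u → ι (adjW w u ∧ (dist a u ≡ᵇ i))

  degreeW : W → ℕ
  degreeW w = ∑ (elems vertices) λ u → ι (adjW w u)

  degree-degreeW : ∀ w → degree w ≡ degreeW (at w)
  degree-degreeW w = count-lookup (elems vertices) (adjW (at w))

  count-sphere : ∀ a w i → count (λ u → adj w u ∧ isDist a u i) ≡ sphere (at a) (at w) i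
  count-sphere a w i = trans (count-cong λ u → cong (adj w u ∧_) (isDist-dist a u i))
    (count-lookup (elems vertices) (λ u → adjW (at w) u ∧ (dist (at a) u ≡ᵇ i)))

  -- The step law in both directions leaves a difference of at most 1, and `parity` rules out
  -- equality.
  neighbour-dist : ∀ a w u → adjW w u ≡ true → suc (dist a u) ≡ dist a w ⊎ dist a u ≡ suc (dist a w)
  neighbour-dist a w u wu with m≤n⇒m<n∨m≡n (dist-step a w u wu)
  ... | inj₂ e = inj₂ e
  ... | inj₁ (s≤s le) with m≤n⇒m<n∨m≡n le
  ...   | inj₂ e = contradiction (sym e) (parity a w u wu)
  ...   | inj₁ lt = inj₁ (≤-antisym lt (dist-step a u w (trans (adjW-sym u w) wu)))

  spheres : ∀ a w i → dist a w ≡ suc i → sphere a w i + sphere a w (suc (suc i)) ≡ degreeW w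
  spheres a w i e = trans (sym (∑-+ (elems vertices) _ _)) (∑-cong (elems vertices) pointwise)
    where
    pointwise : ∀ u → ι (adjW w u ∧ (dist a u ≡ᵇ i)) + ι (adjW w u ∧ (dist a u ≡ᵇ suc (suc i))) ≡ ι (adjW w u)
    pointwise u with adjW w u in wu
    ... | false = refl
    ... | true with neighbour-dist a w u wu
    ...   | inj₁ e′ rewrite suc-injective (trans e′ e) | ≡ᵇ-refl i | ≡ᵇ-false (<⇒≢ (m≤n⇒m≤1+n (≤-refl {suc i}))) = refl
    ...   | inj₂ e′ rewrite trans e′ (cong suc e) | ≡ᵇ-refl i | ≡ᵇ-false (≢-sym (<⇒≢ (m≤n⇒m≤1+n (≤-refl {suc i})))) = refl

  sphere-origin : ∀ a w → dist a w ≡ 0 → sphere a w 1 ≡ degreeW w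
  sphere-origin a w e = ∑-cong (elems vertices) pointwise
    where
    pointwise : ∀ u → ι (adjW w u ∧ (dist a u ≡ᵇ 1)) ≡ ι (adjW w u)
    pointwise u with adjW w u in wu
    ... | false = refl
    ... | true with neighbour-dist a w u wu
    ...   | inj₁ e′ = contradiction (trans e′ e) λ ()
    ...   | inj₂ e′ rewrite trans e′ (cong suc e) = refl

  -- This is c_i indexed by the distance i of `w`. Setting c₀ = 0 makes b_i = degree - c_i valid at
  -- i = 0 as well.
  inner-sphere : W → W → ℕ → ℕ
  inner-sphere a w zero    = 0
  inner-sphere a w (suc i) = sphere a w i

  outer-sphere : ∀ a w i → dist a w ≡ i → sphere a w (suc i) ≡ degreeW w ∸ inner-sphere a w i
  outer-sphere a w zero    e = sphere-origin a w e
  outer-sphere a w (suc i) e = sym (trans (cong (_∸ sphere a w i) (sym (spheres a w i e))) (m+n∸m≡n (sphere a w i) _))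

  -- The outer intersection numbers are what the inner ones leave of the degrees.
  distance-biregular : ∀ {k l dY dZ} (cY : Vec ℕ dY) (cZ : Vec ℕ dZ) (valency : Bool → ℕ → ℕ) (inner : Bool → ℕ → ℕ) →
    (∀ a w → degreeW w ≡ valency (inYW a) (dist a w)) →
    (∀ a w → inner-sphere a w (dist a w) ≡ inner (inYW a) (dist a w)) →
    valency true 0 ≡ k → valency false 0 ≡ l →
    (∀ i → inner true (suc (toℕ i)) ≡ Vec.lookup cY i) →
    (∀ i → inner false (suc (toℕ i)) ≡ Vec.lookup cZ i) →
    (∃ λ a → inYW a ≡ true) → (∃ λ a → inYW a ≡ false) →
    (∀ a b → inYW a ≡ true → dist a b ≤ dY) → (∀ a → inYW a ≡ true → ∃ λ b → dist a b ≡ dY) →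
    (∀ a b → inYW a ≡ false → dist a b ≤ dZ) → (∀ a → inYW a ≡ false → ∃ λ b → dist a b ≡ dZ) →
    DistanceBiregular graph k l dY dZ cY cZ
  distance-biregular {k} {l} {dY} {dZ} cY cZ valency inner val inn vk vl iY iZ y z bY aY bZ aZ = record
    { Y-nonempty = nonempty y
    ; Z-nonempty = nonempty z
    ; valY = λ a e → trans (degrees a e) vk
    ; valZ = λ a e → trans (degrees a e) vl
    ; eccY-bound = λ a e w → dist⇒walk dY a w (bY (at a) (at w) e)
    ; eccY-attained = λ a e → attained a (aY (at a) e)
    ; eccZ-bound = λ a e w → dist⇒walk dZ a w (bZ (at a) (at w) e)
    ; eccZ-attained = λ a e → attained a (aZ (at a) e)
    ; cY-val = λ a e i w d → trans (inner-number a e (toℕ i) w d) (iY i)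
    ; cZ-val = λ a e i w d → trans (inner-number a e (toℕ i) w d) (iZ i)
    ; bY-reg = (λ i → valency true i ∸ inner true i) , λ a e → outer-number a e
    ; bZ-reg = (λ i → valency false i ∸ inner false i) , λ a e → outer-number a e }
    where
    nonempty : ∀ {b} → (∃ λ a → inYW a ≡ b) → ∃ λ a → inY a ≡ b
    nonempty (a , e) = number a , trans (cong inYW (at-number a)) e
    degrees : ∀ a {b} → inY a ≡ b → degree a ≡ valency b 0
    degrees a refl = trans (degree-degreeW a) (trans (val (at a) (at a)) (cong (valency (inY a)) (dist-self (at a))))
    attained : ∀ a {d} → (∃ λ b → dist (at a) b ≡ d) → ∃ λ w → Dist a w d
    attained a (b , e) = number b , ⇒Dist a (number b) _ (trans (cong (dist (at a)) (at-number b)) e)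
    inner-at : ∀ a w i → Dist a w i → inner-sphere (at a) (at w) i ≡ inner (inY a) i
    inner-at a w i d = subst (λ j → inner-sphere (at a) (at w) j ≡ inner (inY a) j) (Dist⇒ a w i d) (inn (at a) (at w))
    inner-number : ∀ a {b} → inY a ≡ b → ∀ i w → Dist a w (suc i) → cnum a w (suc i) ≡ inner b (suc i)
    inner-number a refl i w d = trans (count-sphere a w i) (inner-at a w (suc i) d)
    outer-number : ∀ a {b} → inY a ≡ b → ∀ i w → Dist a w i → bnum a w i ≡ valency b i ∸ inner b i
    outer-number a refl i w d = trans (count-sphere a w (suc i)) (trans (outer-sphere (at a) (at w) i (Dist⇒ a w i d))
      (cong₂ _∸_ (trans (val (at a) (at w)) (cong (valency (inY a)) (Dist⇒ a w i d))) (inner-at a w i d)))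

-- The graph of a code

module CodeGraph (h : ℕ) (0<h : 0 < h) (C : Code h) where
  open Code C

  Place : Set
  Place = Index × Symbol

  Vertex : Set
  Vertex = Word ⊎ Place

  places : Finite Place
  places = indices ⊗ symbols

  vertices : Finite Vertex
  vertices = words ⊕ places

  infix 4 _≟S_ _≟I_ _≟W_
  _≟S_ = _≟_ symbols
  _≟I_ = _≟_ indices
  _≟W_ = _≟_ words

  isWord : Vertex → Bool
  isWord (inj₁ _) = true
  isWord (inj₂ _) = false

  through : Word → Place → Bool
  through x (i , s) = does (x ! i ≟S s)

  adjacent : Vertex → Vertex → Bool
  adjacent (inj₁ x) (inj₂ p) = through x p
  adjacent (inj₂ p) (inj₁ x) = through x p
  adjacent (inj₁ _) (inj₁ _) = false
  adjacent (inj₂ _) (inj₂ _) = false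

  adjacent-sym : ∀ u v → adjacent u v ≡ adjacent v u
  adjacent-sym (inj₁ _) (inj₁ _) = refl
  adjacent-sym (inj₁ _) (inj₂ _) = refl
  adjacent-sym (inj₂ _) (inj₁ _) = refl
  adjacent-sym (inj₂ _) (inj₂ _) = refl

  adjacent-bipartite : ∀ u v → adjacent u v ≡ true → isWord u ≢ isWord v
  adjacent-bipartite (inj₁ _) (inj₂ _) _ ()
  adjacent-bipartite (inj₂ _) (inj₁ _) _ ()

  -- The argument is the number of agreements of two distinct words: an agreement is a common
  -- neighbour.
  word-distance : ℕ → ℕ
  word-distance zero    = 4
  word-distance (suc _) = 2

  -- The flags tell whether the indices and the symbols coincide. A word has only one symbol at each
  -- index, so different symbols at one index have no common word, while places at different indices
  -- share h > 0 words.
  place-distance : Bool → Bool → ℕ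
  place-distance true  true  = 0
  place-distance true  false = 4
  place-distance false _     = 2

  distance : Vertex → Vertex → ℕ
  distance (inj₁ x) (inj₁ y) = if does (x ≟W y) then 0 else word-distance (agreements x y)
  distance (inj₁ x) (inj₂ p) = if through x p then 1 else 3
  distance (inj₂ p) (inj₁ x) = if through x p then 1 else 3
  distance (inj₂ (i , s)) (inj₂ (j , t)) = place-distance (does (i ≟I j)) (does (s ≟S t))

  common-word : ∀ {i j} → i ≢ j → ∀ s t → ∃ λ x → x ! i ≡ s × x ! j ≡ t
  common-word {i} {j} i≢j s t with x , pos ← ∑-positive (elems words) _ (subst (0 <_) (sym (strength i≢j s t)) 0<h) =
    x , both (x ! i ≟S s) (x ! j ≟S t) pos
    where
    both : {P Q : Set} (d : Dec P) (d′ : Dec Q) → 0 < ι (does d) * ι (does d′) → P × Q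
    both (yes p) (yes q) _ = p , q

  other-index : ∀ i → ∃ λ j → i ≢ j
  other-index i with i ≟I i₀
  ... | yes refl = i₁ , i₀≢i₁
  ... | no i≢i₀  = i₀ , i≢i₀

  agreements-positive : ∀ x y i → x ! i ≡ y ! i → 0 < agreements x y
  agreements-positive x y i e = subst (_≤ agreements x y) (ι-yes (x ! i ≟S y ! i) e)
    (≤∑ indices i λ i → δ symbols (x ! i) (y ! i))

  no-agreement : ∀ x y → agreements x y ≡ 0 → ∀ i → x ! i ≢ y ! i
  no-agreement x y z i e = contradiction (subst (0 <_) z (agreements-positive x y i e)) λ ()

  word-distance-≤2 : ∀ {n} → 0 < n → word-distance n ≡ 2
  word-distance-≤2 {suc _} _ = refl

  word-distance-≤4 : ∀ n → word-distance n ≤ 4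
  word-distance-≤4 zero    = ≤-refl
  word-distance-≤4 (suc _) = s≤s (s≤s z≤n)

  2≤word-distance : ∀ n → 2 ≤ word-distance n
  2≤word-distance zero    = s≤s (s≤s z≤n)
  2≤word-distance (suc _) = ≤-refl

  distance-self : ∀ a → distance a a ≡ 0
  distance-self (inj₁ x) rewrite dec-true (x ≟W x) refl = refl
  distance-self (inj₂ (i , s)) rewrite dec-true (i ≟I i) refl | dec-true (s ≟S s) refl = refl

  distance-zero : ∀ a b → distance a b ≡ 0 → a ≡ b
  distance-zero (inj₁ x) (inj₁ y) e with x ≟W y
  ... | yes refl = refl
  ... | no _     = contradiction (subst (2 ≤_) e (2≤word-distance (agreements x y))) λ ()
  distance-zero (inj₁ x) (inj₂ p) e with through x p | e
  ... | true  | ()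
  ... | false | ()
  distance-zero (inj₂ p) (inj₁ x) e with through x p | e
  ... | true  | ()
  ... | false | ()
  distance-zero (inj₂ (i , s)) (inj₂ (j , t)) e with i ≟I j | s ≟S t | e
  ... | yes refl | yes refl | _ = refl

  distance-≤4 : ∀ a b → distance a b ≤ 4
  distance-≤4 (inj₁ x) (inj₁ y) with x ≟W y
  ... | yes _ = z≤n
  ... | no _  = word-distance-≤4 (agreements x y)
  distance-≤4 (inj₁ x) (inj₂ p) with through x p
  ... | true  = s≤s z≤n
  ... | false = s≤s (s≤s (s≤s z≤n))
  distance-≤4 (inj₂ p) (inj₁ x) with through x p
  ... | true  = s≤s z≤n
  ... | false = s≤s (s≤s (s≤s z≤n))
  distance-≤4 (inj₂ (i , s)) (inj₂ (j , t)) with does (i ≟I j) | does (s ≟S t)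
  ... | true  | true  = z≤n
  ... | true  | false = ≤-refl
  ... | false | _     = s≤s (s≤s z≤n)

  distance-step : ∀ a u b → adjacent u b ≡ true → distance a b ≤ suc (distance a u)
  distance-step (inj₁ x) (inj₁ y) (inj₂ (i , s)) ub with x ≟W y
  ... | yes refl rewrite ub = ≤-refl
  ... | no _ with through x (i , s)
  ...   | true  = s≤s z≤n
  ...   | false = s≤s (2≤word-distance (agreements x y))
  distance-step (inj₁ x) (inj₂ (i , s)) (inj₁ y) ub with x ! i ≟S s
  ... | no _ = distance-≤4 (inj₁ x) (inj₁ y)
  ... | yes refl with x ≟W y
  ...   | yes _ = z≤n
  ...   | no _  = ≤-reflexive (word-distance-≤2 (agreements-positive x y i (sym (does⇒ (y ! i ≟S x ! i) ub))))
  distance-step (inj₂ (i , s)) (inj₁ y) (inj₂ (j , t)) ub with y ! i ≟S s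
  ... | no _ = distance-≤4 (inj₂ (i , s)) (inj₂ (j , t))
  ... | yes refl with i ≟I j
  ...   | no _ = ≤-refl
  ...   | yes refl rewrite ub = z≤n
  distance-step (inj₂ (i , s)) (inj₂ (j , t)) (inj₁ y) ub with i ≟I j | s ≟S t
  ... | yes refl | yes refl rewrite ub = ≤-refl
  ... | yes refl | no _ = ≤-trans (near-≤3 (through y (i , s))) (m≤n+m 3 2)
    where
    near-≤3 : ∀ b → (if b then 1 else 3) ≤ 3
    near-≤3 true  = s≤s z≤n
    near-≤3 false = ≤-refl
  ... | no _ | _ with through y (i , s)
  ...   | true  = s≤s z≤n
  ...   | false = ≤-refl

  distance-pred : ∀ a b {k} → distance a b ≡ suc k → ∃ λ u → distance a u ≡ k × adjacent u b ≡ true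
  distance-pred (inj₁ x) (inj₁ y) e with x ≟W y
  ... | no _ with agreements x y in eq | e
  -- Without agreements `x` misses every place of `y`, so any index serves, and the place there is
  -- at distance 3 from `x`.
  ...   | zero | refl = inj₂ (i₀ , y ! i₀) ,
    cong (λ b → if b then 1 else 3) (dec-false (x ! i₀ ≟S y ! i₀) (no-agreement x y eq i₀)) ,
    dec-true (y ! i₀ ≟S y ! i₀) refl
  ...   | suc _ | refl with i , pos ← ∑-positive (elems indices) (λ i → δ symbols (x ! i) (y ! i))
                                  (subst (0 <_) (sym eq) (s≤s z≤n))
    with yes e′ ← x ! i ≟S y ! i = inj₂ (i , y ! i) ,
    cong (λ b → if b then 1 else 3) (dec-true (x ! i ≟S y ! i) e′) , dec-true (y ! i ≟S y ! i) refl
  distance-pred (inj₁ x) (inj₂ (i , s)) e with x ! i ≟S s | e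
  ... | yes e′ | refl = inj₁ x , distance-self (inj₁ x) , dec-true (x ! i ≟S s) e′
  -- The intermediate word passes through `(i , s)` and copies the symbol of `x` at a second index,
  -- which puts it at distance 2 from `x`.
  ... | no xi≢s | refl with j , i≢j ← other-index i with y , yi , yj ← common-word i≢j s (x ! j) =
    inj₁ y , close , dec-true (y ! i ≟S s) yi
    where
    close : distance (inj₁ x) (inj₁ y) ≡ 2
    close with x ≟W y
    ... | yes refl = contradiction yi xi≢s
    ... | no _     = word-distance-≤2 (agreements-positive x y j (sym yj))
  distance-pred (inj₂ (i , s)) (inj₁ y) e with y ! i ≟S s | e
  ... | yes e′ | refl = inj₂ (i , s) , distance-self (inj₂ (i , s)) , dec-true (y ! i ≟S s) e′
  ... | no _   | refl with j , i≢j ← other-index i =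
    inj₂ (j , y ! j) , cong (λ b → place-distance b (does (s ≟S y ! j))) (dec-false (i ≟I j) i≢j) ,
    dec-true (y ! j ≟S y ! j) refl
  distance-pred (inj₂ (i , s)) (inj₂ (j , t)) e with i ≟I j | s ≟S t | e
  -- Any word through `(i , t)` will do: it misses `(i , s)` and is therefore at distance 3 from it.
  ... | yes refl | no s≢t | refl with j , i≢j ← other-index i with y , yi , _ ← common-word i≢j t t =
    inj₁ y , cong (λ b → if b then 1 else 3) (dec-false (y ! i ≟S s) (λ e → s≢t (trans (sym e) yi))) ,
    dec-true (y ! i ≟S t) yi
  ... | no i≢j | _ | refl with y , yi , yj ← common-word i≢j s t =
    inj₁ y , cong (λ b → if b then 1 else 3) (dec-true (y ! i ≟S s) yi) , dec-true (y ! j ≟S t) yj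

  even : ℕ → Bool
  even zero    = true
  even (suc n) = not (even n)

  -- This serves twice: it shows that adjacent vertices are never equidistant from `a`, and it lets
  -- the degree of a vertex be read off from its distance to `a`.
  even-distance : ∀ a b → (if even (distance a b) then isWord a else not (isWord a)) ≡ isWord b
  even-distance (inj₁ x) (inj₁ y) with x ≟W y | agreements x y
  ... | yes _ | _     = refl
  ... | no _  | zero  = refl
  ... | no _  | suc _ = refl
  even-distance (inj₁ x) (inj₂ p) with through x p
  ... | true  = refl
  ... | false = refl
  even-distance (inj₂ p) (inj₁ x) with through x p
  ... | true  = refl
  ... | false = refl
  even-distance (inj₂ (i , s)) (inj₂ (j , t)) with does (i ≟I j) | does (s ≟S t)
  ... | true  | true  = refl
  ... | true  | false = refl
  ... | false | _     = refl

  metric : Metric Vertex adjacent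
  metric = record
    { dist = distance ; dist-self = distance-self ; dist-zero = distance-zero
    ; dist-step = distance-step ; dist-pred = distance-pred
    ; parity = λ a u b ub e → adjacent-bipartite u b ub (trans (sym (even-distance a u))
        (trans (cong (λ n → if even n then isWord a else not (isWord a)) e) (even-distance a b))) }

  open MetricGraph vertices isWord adjacent adjacent-sym adjacent-bipartite metric

  -- Degrees and sphere sizes in the code graph.

  valency-place : ℕ
  valency-place = size symbols * h

  valency-word : ℕ
  valency-word = size indices

  ∑-vertices : (f : Vertex → ℕ) → ∑ (elems vertices) f ≡
               ∑ (elems words) (f ∘ inj₁) + ∑ (elems indices) (λ i → ∑ (elems symbols) λ s → f (inj₂ (i , s)))
  ∑-vertices f = trans (∑-⊕ words places f)
    (cong (∑ (elems words) (f ∘ inj₁) +_) (∑-× (elems indices) (elems symbols) (f ∘ inj₂)))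

  ∑-words : (f : Vertex → ℕ) → (∀ p → f (inj₂ p) ≡ 0) → ∑ (elems vertices) f ≡ ∑ (elems words) (f ∘ inj₁)
  ∑-words f z = trans (∑-vertices f) (trans (cong (∑ (elems words) (f ∘ inj₁) +_)
    (∑-zero (elems indices) λ i → ∑-zero (elems symbols) λ s → z (i , s))) (+-identityʳ _))

  ∑-places : (f : Vertex → ℕ) → (∀ x → f (inj₁ x) ≡ 0) →
             ∑ (elems vertices) f ≡ ∑ (elems indices) (λ i → ∑ (elems symbols) λ s → f (inj₂ (i , s)))
  ∑-places f z = trans (∑-vertices f) (cong₂ _+_ (∑-zero (elems words) z) refl)

  degree-word : ∀ x → degreeW (inj₁ x) ≡ valency-word
  degree-word x = begin
    degreeW (inj₁ x) ≡⟨ ∑-places (λ u → ι (adjacent (inj₁ x) u)) (λ _ → refl) ⟩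
    ∑ (elems indices) (λ i → ∑ (elems symbols) λ s → δ symbols (x ! i) s)
      ≡⟨ ∑-cong (elems indices) (λ i → ∑-δ-sym symbols (x ! i)) ⟩
    ∑ (elems indices) (λ _ → 1) ≡⟨ ∑-one (elems indices) ⟩
    valency-word ∎
    where open ≡-Reasoning

  -- At a second index the words through `(i , s)` split by their symbol into classes of size h, by
  -- `strength`.
  words-through : ∀ i s → ∑ (elems words) (λ x → δ symbols (x ! i) s) ≡ valency-place
  words-through i s with j , i≢j ← other-index i = begin
    ∑ (elems words) (λ x → δ symbols (x ! i) s) ≡⟨ ∑-cong (elems words) expand ⟩
    ∑ (elems words) (λ x → ∑ (elems symbols) λ t → δ symbols (x ! i) s * δ symbols (x ! j) t)
      ≡⟨ ∑-swap (elems words) (elems symbols) _ ⟩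
    ∑ (elems symbols) (λ t → ∑ (elems words) λ x → δ symbols (x ! i) s * δ symbols (x ! j) t)
      ≡⟨ ∑-cong (elems symbols) (strength i≢j s) ⟩
    ∑ (elems symbols) (λ _ → h) ≡⟨ ∑-const (elems symbols) h ⟩
    valency-place ∎
    where
    open ≡-Reasoning
    expand : ∀ x → δ symbols (x ! i) s ≡ ∑ (elems symbols) λ t → δ symbols (x ! i) s * δ symbols (x ! j) t
    expand x = sym (trans (∑-*ˡ (elems symbols) (δ symbols (x ! i) s) _)
      (trans (cong (δ symbols (x ! i) s *_) (∑-δ-sym symbols (x ! j))) (*-identityʳ _)))

  degree-place : ∀ p → degreeW (inj₂ p) ≡ valency-place
  degree-place (i , s) = trans (∑-words (λ u → ι (adjacent (inj₂ (i , s)) u)) (λ _ → refl)) (words-through i s)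

  sphere-word-1 : ∀ x p → through x p ≡ true → sphere (inj₁ x) (inj₂ p) 0 ≡ 1
  sphere-word-1 x p xp = trans (∑-words _ λ _ → refl) (trans (∑-cong (elems words) pointwise) (∑-δ words x))
    where
    pointwise : ∀ y → ι (through y p ∧ (distance (inj₁ x) (inj₁ y) ≡ᵇ 0)) ≡ δ words y x
    pointwise y with x ≟W y
    ... | yes refl rewrite xp | dec-true (x ≟W x) refl = refl
    ... | no x≢y rewrite dec-false (y ≟W x) (x≢y ∘ sym) with through y p | agreements x y
    ...   | false | _     = refl
    ...   | true  | zero  = refl
    ...   | true  | suc _ = refl

  near-1 : ∀ b → ((if b then 1 else 3) ≡ᵇ 1) ≡ b
  near-1 true  = refl
  near-1 false = refl

  sphere-word-2 : ∀ x y → sphere (inj₁ x) (inj₁ y) 1 ≡ agreements x y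
  sphere-word-2 x y = trans (∑-places _ λ _ → refl) (∑-cong (elems indices) λ i →
    trans (∑-cong (elems symbols) λ s → trans (cong (λ b → ι (through y (i , s) ∧ b)) (near-1 (through x (i , s))))
        (pointwise i s))
      (∑-δ* symbols (y ! i) (λ s → δ symbols (x ! i) s)))
    where
    pointwise : ∀ i s → ι (through y (i , s) ∧ through x (i , s)) ≡ δ symbols s (y ! i) * δ symbols (x ! i) s
    pointwise i s = trans (ι-∧ (through y (i , s)) (through x (i , s)))
      (cong (_* ι (through x (i , s))) (ι-cong (y ! i ≟S s) (s ≟S y ! i) sym sym))

  sphere-word-4 : ∀ x y → agreements x y ≡ 0 → sphere (inj₁ x) (inj₁ y) 3 ≡ valency-word
  sphere-word-4 x y none = trans (∑-cong (elems vertices) pointwise) (degree-word y)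
    where
    pointwise : ∀ u → ι (adjacent (inj₁ y) u ∧ (distance (inj₁ x) u ≡ᵇ 3)) ≡ ι (adjacent (inj₁ y) u)
    pointwise (inj₁ _) = refl
    pointwise (inj₂ (i , s)) with y ! i ≟S s
    ... | no _     = refl
    ... | yes refl rewrite dec-false (x ! i ≟S y ! i) (no-agreement x y none i) = refl

  -- Double counting of the pairs (y, j) with y through (i, s) and y ! j = x ! j.
  sphere-word-3 : ∀ x i s → x ! i ≢ s → sphere (inj₁ x) (inj₂ (i , s)) 2 * 2 + h ≡ size indices * h
  sphere-word-3 x i s xi≢s = begin
    sphere (inj₁ x) (inj₂ (i , s)) 2 * 2 + h ≡⟨ cong (λ n → n * 2 + h) (∑-words _ λ _ → refl) ⟩
    ∑ (elems words) close * 2 + h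
      ≡⟨ cong (_+ h) (trans (*-comm (∑ (elems words) close) 2) (sym (∑-*ˡ (elems words) 2 close))) ⟩
    ∑ (elems words) (λ y → 2 * close y) + h ≡⟨ cong (_+ h) (∑-cong (elems words) pointwise) ⟩
    ∑ (elems words) (λ y → δ symbols (y ! i) s * agreements x y) + h
      ≡⟨ cong (_+ h) (∑-cong (elems words) λ y → ∑-*ˡ (elems indices) (δ symbols (y ! i) s) _) ⟨
    ∑ (elems words) (λ y → ∑ (elems indices) λ j → δ symbols (y ! i) s * δ symbols (x ! j) (y ! j)) + h
      ≡⟨ cong (_+ h) (∑-swap (elems words) (elems indices) _) ⟩
    ∑ (elems indices) column + h ≡⟨ cong (∑ (elems indices) column +_) (∑-δ* indices i (λ _ → h)) ⟨
    ∑ (elems indices) column + ∑ (elems indices) (λ j → δ indices j i * h) ≡⟨ ∑-+ (elems indices) _ _ ⟨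
    ∑ (elems indices) (λ j → column j + δ indices j i * h) ≡⟨ ∑-cong (elems indices) full ⟩
    ∑ (elems indices) (λ _ → h) ≡⟨ ∑-const (elems indices) h ⟩
    size indices * h ∎
    where
    open ≡-Reasoning
    close : Word → ℕ
    close y = ι (through y (i , s) ∧ (distance (inj₁ x) (inj₁ y) ≡ᵇ 2))
    column : Index → ℕ
    column j = ∑ (elems words) λ y → δ symbols (y ! i) s * δ symbols (x ! j) (y ! j)
    twice : ∀ {n} → n ≡ 0 ⊎ n ≡ 2 → 2 * ι (word-distance n ≡ᵇ 2) ≡ 1 * n
    twice (inj₁ refl) = refl
    twice (inj₂ refl) = refl
    pointwise : ∀ y → 2 * close y ≡ δ symbols (y ! i) s * agreements x y
    pointwise y with y ! i ≟S s
    ... | no _ = refl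
    ... | yes refl with x ≟W y
    ...   | yes refl = contradiction refl xi≢s
    ...   | no x≢y   = twice (agreements-0∨2 x≢y)
    full : ∀ j → column j + δ indices j i * h ≡ h
    full j with j ≟I i
    ... | yes refl = cong₂ _+_ (∑-zero (elems words) vanish) (+-identityʳ h)
      where
      vanish : ∀ y → δ symbols (y ! j) s * δ symbols (x ! j) (y ! j) ≡ 0
      vanish y with y ! j ≟S s
      ... | no _     = refl
      ... | yes refl rewrite dec-false (x ! j ≟S y ! j) xi≢s = refl
    ... | no j≢i = trans (+-identityʳ _) (trans
      (∑-cong (elems words) λ y → cong (δ symbols (y ! i) s *_) (ι-cong (x ! j ≟S y ! j) (y ! j ≟S x ! j) sym sym))
      (strength (j≢i ∘ sym) s (x ! j)))

  sphere-place-1 : ∀ p x → through x p ≡ true → sphere (inj₂ p) (inj₁ x) 0 ≡ 1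
  sphere-place-1 (i , s) x xp = trans (∑-cong (elems vertices) pointwise) (∑-δ vertices (inj₂ (i , s)))
    where
    pointwise : ∀ u → ι (adjacent (inj₁ x) u ∧ (distance (inj₂ (i , s)) u ≡ᵇ 0)) ≡ δ vertices u (inj₂ (i , s))
    pointwise (inj₁ _) = refl
    pointwise (inj₂ (j , t)) = trans (by-cases (i ≟I j) (s ≟S t)) (sym (δ-⊗ indices symbols j t i s))
      where
      by-cases : (d : Dec (i ≡ j)) (d′ : Dec (s ≡ t)) →
        ι (through x (j , t) ∧ (place-distance (does d) (does d′) ≡ᵇ 0)) ≡ δ indices j i * δ symbols t s
      by-cases (yes refl) (yes refl) rewrite xp | dec-true (i ≟I i) refl | dec-true (s ≟S s) refl = refl
      by-cases (yes refl) (no s≢t) rewrite dec-false (t ≟S s) (s≢t ∘ sym) =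
        trans (cong ι (Bool.∧-zeroʳ (through x (j , t)))) (sym (*-zeroʳ (δ indices j j)))
      by-cases (no i≢j) _ rewrite dec-false (j ≟I i) (i≢j ∘ sym) = cong ι (Bool.∧-zeroʳ (through x (j , t)))

  sphere-place-2 : ∀ {i j} → i ≢ j → ∀ s t → sphere (inj₂ (i , s)) (inj₂ (j , t)) 1 ≡ h
  sphere-place-2 {i} {j} i≢j s t = trans (∑-words _ λ _ → refl) (trans
    (∑-cong (elems words) λ y → trans (cong (λ b → ι (through y (j , t) ∧ b)) (near-1 (through y (i , s))))
      (ι-∧ (through y (j , t)) (through y (i , s))))
    (strength (i≢j ∘ sym) t s))

  -- The word `y` has one place at each index. The place at `i` is at distance 0 or 4 from
  -- `(i , s)`, and all the others are at distance 2.
  sphere-place-3 : ∀ i s y → sphere (inj₂ (i , s)) (inj₁ y) 2 + 1 ≡ size indices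
  sphere-place-3 i s y = begin
    sphere (inj₂ (i , s)) (inj₁ y) 2 + 1 ≡⟨ cong₂ _+_ (∑-places _ λ _ → refl) (sym (∑-δ indices i)) ⟩
    ∑ (elems indices) row + ∑ (elems indices) (λ j → δ indices j i) ≡⟨ ∑-+ (elems indices) row _ ⟨
    ∑ (elems indices) (λ j → row j + δ indices j i) ≡⟨ ∑-cong (elems indices) full ⟩
    ∑ (elems indices) (λ _ → 1) ≡⟨ ∑-one (elems indices) ⟩
    size indices ∎
    where
    open ≡-Reasoning
    row : Index → ℕ
    row j = ∑ (elems symbols) λ t → ι (through y (j , t) ∧ (distance (inj₂ (i , s)) (inj₂ (j , t)) ≡ᵇ 2))
    not-2 : ∀ b → (place-distance true b ≡ᵇ 2) ≡ false
    not-2 true  = refl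
    not-2 false = refl
    full : ∀ j → row j + δ indices j i ≡ 1
    full j with i ≟I j
    ... | yes refl = cong₂ _+_ (∑-zero (elems symbols) λ t →
        trans (cong (λ b → ι (through y (j , t) ∧ b)) (not-2 (does (s ≟S t))))
          (cong ι (Bool.∧-zeroʳ (through y (j , t)))))
      (ι-yes (j ≟I j) refl)
    ... | no i≢j = cong₂ _+_ (trans (∑-cong (elems symbols) λ t → cong ι (Bool.∧-identityʳ (through y (j , t))))
        (∑-δ-sym symbols (y ! j)))
      (ι-no (j ≟I i) (i≢j ∘ sym))

  sphere-place-4 : ∀ i {s t} → s ≢ t → sphere (inj₂ (i , s)) (inj₂ (i , t)) 3 ≡ valency-place
  sphere-place-4 i {s} {t} s≢t = trans (∑-cong (elems vertices) pointwise) (degree-place (i , t))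
    where
    pointwise : ∀ u → ι (adjacent (inj₂ (i , t)) u ∧ (distance (inj₂ (i , s)) u ≡ᵇ 3)) ≡ ι (adjacent (inj₂ (i , t)) u)
    pointwise (inj₂ _) = refl
    pointwise (inj₁ y) with y ! i ≟S t
    ... | no _     = refl
    ... | yes refl rewrite dec-false (y ! i ≟S s) (s≢t ∘ sym) = refl

  -- Assembling the intersection array.

  module _ (q : ℕ) (q≡ : q ≡ h + h) where

    cY cZ : Vec ℕ 4
    cY = 1 ∷ 2 ∷ ((q + 1) * q) / 4 ∷ q + 2 ∷ []
    cZ = 1 ∷ q / 2 ∷ q + 1 ∷ (q * (q ∸ 1)) / 2 ∷ []

    -- The degree of a vertex at distance `i` from one in part `b`: even distances stay in the part,
    -- odd ones change it.
    valency : Bool → ℕ → ℕ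
    valency b i = if (if even i then b else not b) then valency-word else valency-place

    -- The last clause of each part is meant for distance 4, the largest that occurs. There every
    -- neighbour is closer, so the value is the full degree.
    inner : Bool → ℕ → ℕ
    inner b     0 = 0
    inner true  1 = 1
    inner true  2 = 2
    inner true  3 = ((q + 1) * q) / 4
    inner true  _ = valency-word
    inner false 1 = 1
    inner false 2 = h
    inner false 3 = q + 1
    inner false _ = valency-place

    valency-word≡ : valency-word ≡ q + 2
    valency-word≡ = trans size-indices (cong (_+ 2) (sym q≡))

    q≡h*2 : q ≡ h * 2
    q≡h*2 = trans q≡ (trans (cong (h +_) (sym (+-identityʳ h))) (*-comm 2 h))

    q/2≡ : q / 2 ≡ h
    q/2≡ = trans (cong (_/ 2) q≡h*2) (m*n/n≡m h 2)

    valency-place≡ : valency-place ≡ (q * (q ∸ 1)) / 2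
    valency-place≡ = sym (trans (cong (_/ 2) (begin
      q * (q ∸ 1)          ≡⟨ cong (λ k → q * (k ∸ 1)) (trans q≡ (sym size-symbols)) ⟩
      q * (size symbols + 1 ∸ 1) ≡⟨ cong (q *_) (m+n∸n≡m (size symbols) 1) ⟩
      q * size symbols     ≡⟨ *-comm q (size symbols) ⟩
      size symbols * q     ≡⟨ cong (size symbols *_) q≡h*2 ⟩
      size symbols * (h * 2) ≡⟨ *-assoc (size symbols) h 2 ⟨
      size symbols * h * 2 ∎)) (m*n/n≡m (size symbols * h) 2))
      where open ≡-Reasoning

    -- The double count itself supplies the divisibility: subtracting h gives 2c = (q + 1) h, and
    -- doubling exhibits (q + 1) q as 4c.
    quarter : ∀ c → c * 2 + h ≡ size indices * h → c ≡ ((q + 1) * q) / 4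
    quarter c e = sym (trans (cong (_/ 4) (begin
      (q + 1) * q         ≡⟨ cong ((q + 1) *_) q≡h*2 ⟩
      (q + 1) * (h * 2)   ≡⟨ *-assoc (q + 1) h 2 ⟨
      (q + 1) * h * 2     ≡⟨ cong (_* 2) c*2 ⟨
      c * 2 * 2           ≡⟨ *-assoc c 2 2 ⟩
      c * 4               ∎)) (m*n/n≡m c 4))
      where
      open ≡-Reasoning
      c*2 : c * 2 ≡ (q + 1) * h
      c*2 = +-cancelʳ-≡ h (c * 2) ((q + 1) * h) (begin
        c * 2 + h           ≡⟨ e ⟩
        size indices * h    ≡⟨ cong (_* h) (trans valency-word≡ (trans (sym (+-assoc q 1 1)) (+-comm (q + 1) 1))) ⟩
        suc (q + 1) * h     ≡⟨ +-comm h ((q + 1) * h) ⟩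
        (q + 1) * h + h     ∎)

    degrees : ∀ a w → degreeW w ≡ valency (isWord a) (distance a w)
    degrees a w = trans (degree-side w)
      (cong (λ b → if b then valency-word else valency-place) (sym (even-distance a w)))
      where
      degree-side : ∀ w → degreeW w ≡ (if isWord w then valency-word else valency-place)
      degree-side (inj₁ x) = degree-word x
      degree-side (inj₂ p) = degree-place p

    inner-spheres : ∀ a w → inner-sphere a w (distance a w) ≡ inner (isWord a) (distance a w)
    inner-spheres (inj₁ x) (inj₁ y) with x ≟W y
    ... | yes _  = refl
    ... | no x≢y = by-agreements (agreements-0∨2 x≢y)
      where
      Good : ℕ → Set
      Good n = inner-sphere (inj₁ x) (inj₁ y) (word-distance n) ≡ inner true (word-distance n)
      by-agreements : agreements x y ≡ 0 ⊎ agreements x y ≡ 2 → Good (agreements x y)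
      by-agreements (inj₁ e) = subst Good (sym e) (sphere-word-4 x y e)
      by-agreements (inj₂ e) = subst Good (sym e) (trans (sphere-word-2 x y) e)
    inner-spheres (inj₁ x) (inj₂ (i , s)) with x ! i ≟S s
    ... | yes e = sphere-word-1 x (i , s) (dec-true (x ! i ≟S s) e)
    ... | no ≢s = quarter _ (sphere-word-3 x i s ≢s)
    inner-spheres (inj₂ (i , s)) (inj₁ y) with y ! i ≟S s
    ... | yes e = sphere-place-1 (i , s) y (dec-true (y ! i ≟S s) e)
    ... | no _  = +-cancelʳ-≡ 1 _ (q + 1) (trans (sphere-place-3 i s y) (trans valency-word≡ (sym (+-assoc q 1 1))))
    inner-spheres (inj₂ (i , s)) (inj₂ (j , t)) with i ≟I j | s ≟S t
    ... | yes refl | yes refl = refl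
    ... | yes refl | no s≢t   = sphere-place-4 i s≢t
    ... | no i≢j   | _        = sphere-place-2 i≢j s t

    biregular : DistanceBiregular graph (q + 2) ((q * (q ∸ 1)) / 2) 4 4 cY cZ
    biregular = distance-biregular cY cZ valency inner degrees inner-spheres valency-word≡ valency-place≡
      (λ { fz → refl ; (fs fz) → refl ; (fs (fs fz)) → refl ; (fs (fs (fs fz))) → valency-word≡ })
      (λ { fz → refl ; (fs fz) → sym q/2≡ ; (fs (fs fz)) → refl ; (fs (fs (fs fz))) → valency-place≡ })
      (inj₁ (proj₁ (common-word i₀≢i₁ s₀ s₀)) , refl) (inj₂ (i₀ , s₀) , refl)
      (λ a b _ → distance-≤4 a b) far-word (λ a b _ → distance-≤4 a b) far-place
      where
      far-word : ∀ a → isWord a ≡ true → ∃ λ b → distance a b ≡ 4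
      far-word (inj₁ x) _ with y , apart ← antipode x = inj₁ y , far
        where
        far : distance (inj₁ x) (inj₁ y) ≡ 4
        far with x ≟W y
        ... | yes refl = contradiction refl (apart i₀)
        ... | no _ = cong word-distance (∑-zero (elems indices) λ i → ι-no (x ! i ≟S y ! i) (apart i))
      far-place : ∀ a → isWord a ≡ false → ∃ λ b → distance a b ≡ 4
      far-place (inj₂ (i , s)) _ with t , s≢t ← another s =
        inj₂ (i , t) , cong₂ place-distance (dec-true (i ≟I i) refl) (dec-false (s ≟S t) s≢t)

theorem6p2 : (m : ℕ) → 2 ≤ m →
    Σ BipGraph λ G →
    DistanceBiregular G (2 ^ m + 2) ((2 ^ m * (2 ^ m ∸ 1)) / 2) 4 4
    (1 ∷ 2 ∷ ((2 ^ m + 1) * 2 ^ m) / 4 ∷ 2 ^ m + 2 ∷ [])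
    (1 ∷ (2 ^ m) / 2 ∷ 2 ^ m + 1 ∷ (2 ^ m * (2 ^ m ∸ 1)) / 2 ∷ [])
theorem6p2 (suc m) (s≤s 1≤m) = _ , CodeGraph.biregular h (m^n>0 2 m) code (2 ^ suc m) q≡
  where
  -- Here `m` is one less than the exponent of q, so `h` is q / 2, and `1≤m` is what gives q > 2.
  h = 2 ^ m
  q≡ : 2 ^ suc m ≡ h + h
  q≡ = cong (h +_) (+-identityʳ h)
  2<q : 2 < h + h
  2<q = subst (2 <_) q≡ (^-monoʳ-< 2 (s≤s (s≤s z≤n)) (s≤s 1≤m))
  open Hyperoval h 2<q (subst GaloisField q≡ (galoisField (suc m) (s≤s 1≤m))) using (code)
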